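{- Assume the Triangle Detection Conjecture. Then there exists an absolute constant $\gamma>0$ such that the following holds: for any integer $k\ge 6$ and any function $f:\mathbb{N}\to\mathbb{N}$, there exists a graph $H$ on $k$ vertices such that there is no algorithm for the problem $\mathrm{SUBCNT}_H$ with expected running time $o(m^{1+\gamma}f(\kappa))$, where $m$ is the number of edges and $\kappa$ the degeneracy of the input graph.
   Context: All graphs are finite, simple, connected, undirected and unweighted (both the input graph $G$ and the pattern $H$). The computational model is the word RAM with words of $O(\log n)$ bits; algorithms are Las Vegas randomized and running times are in expectation. Degeneracy: a graph is $d$-degenerate if every subgraph has a vertex of degree at most $d$. The degeneracy $\kappa=\kappa(G)$ is the smallest integer $d$ such that $G$ is $d$-degenerate. Match: a match of $H$ in $G$ is a bijection $\pi:S\to V(H)$ with $S\subseteq V(G)$ such that for all $u,v\in S$, $\{\pi(u),\pi(v)\}\in E(H)$ implies $\{u,v\}\in E(G)$. Two matches are equivalent if they differ by an automorphism of $H$; $\mathrm{DM}(G,H)$ denotes the number of distinct (pairwise inequivalent) matches, i.e. the number of (not necessarily induced) subgraphs of $G$ isomorphic to $H$. $\mathrm{SUBCNT}_H$ (for a fixed $H$): given $G$, output $\mathrm{DM}(G,H)$. Triangle Detection Conjecture: there exists a constant $\gamma>0$ such that in the word RAM model of $O(\log n)$ bits, any algorithm to detect whether an input graph on $m$ edges has a triangle requires $\Omega(m^{1+\gamma})$ time in expectation. "Running time $o(m^{1+\gamma}f(\kappa))$" means: expected running time at most $h(m)\,m^{1+\gamma}f(\kappa)$ on every input, for some function $h$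 with $h(m)\to 0$ as $m\to\infty$. -}

module Defs where

open import Algebra.Definitions.RawMonoid using (sum)
open import Algebra.Definitions.RawSemiring using (_^_)
open import Data.Bool using (Bool; true; false; T; _∧_; _∨_; _xor_; if_then_else_)
open import Data.Fin using (Fin; toℕ)
open import Data.Fin.Permutation using (Permutation′; _⟨$⟩ʳ_)
open import Data.Fin.Subset using (Subset; Nonempty; _∈_; ∣_∣)
open import Data.Integer using (+_) renaming (∣_∣ to absℤ)
open import Data.List using (List; []; _∷_; length; concatMap; head; drop)
open import Data.List.Membership.Propositional using () renaming (_∈_ to _∈ₗ_)
open import Data.List.Relation.Unary.All using (All)
open import Data.List.Relation.Unary.AllPairs using (AllPairs)
open import Data.Maybe using (Maybe; just; nothing; fromMaybe)
open import Data.Nat as ℕ using (ℕ; zero; suc; NonZero)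
open import Data.Nat.DivMod using () renaming (_/_ to _/ℕ_; _%_ to _%ℕ_)
open import Data.Nat.Logarithm using (⌊log₂_⌋)
open import Data.Nat.Properties using (m^n≢0)
open import Data.Product using (Σ; ∃; ∃-syntax; _×_; _,_; proj₁; proj₂; swap; uncurry)
open import Data.Rational using (ℚ; 0ℚ; 1ℚ; _+_; _*_; _/_; _≤_; _<_; ↥_; ↧ₙ_)
open import Data.Rational.Base using (+-0-rawMonoid; +-*-rawSemiring)
open import Data.Sum using (_⊎_)
open import Data.Vec using (tabulate)
open import Function using (_⇔_; _↔_; Inverse)
open import Relation.Binary.Construct.Closure.ReflexiveTransitive using (Star)
open import Relation.Binary.PropositionalEquality using (_≡_; _≢_)
open import Relation.Nullary using (¬_)

record Graph (n : ℕ) : Set where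
  field
    adj       : Fin n → Fin n → Bool
    symmetric : ∀ u v → adj u v ≡ adj v u
    loopless  : ∀ u → adj u u ≡ false

  Adj : Fin n → Fin n → Set
  Adj u v = T (adj u v)

open Graph public using (Adj)

Connected : ∀ {n} → Graph n → Set
Connected {n} G = NonZero n × (∀ u v → Star (Adj G) u v)

HasTriangle : ∀ {n} → Graph n → Set
HasTriangle G = ∃[ u ] ∃[ v ] ∃[ w ] Adj G u v × Adj G v w × Adj G u w

record Subgraph {n} (G : Graph n) : Set where
  field
    vertices  : Subset n
    nonempty  : Nonempty vertices
    edge      : Fin n → Fin n → Bool
    symmetric : ∀ u v → edge u v ≡ edge v u
    edge⊆G    : ∀ u v → T (edge u v) → Adj G u v
    endpoint  : ∀ u v → T (edge u v) → u ∈ vertices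

  degree : Fin n → ℕ
  degree u = ∣ tabulate (edge u) ∣

Degenerate : ∀ {n} → Graph n → ℕ → Set
Degenerate G d = (F : Subgraph G) →
  ∃[ v ] v ∈ Subgraph.vertices F × Subgraph.degree F v ℕ.≤ d

IsDegeneracy : ∀ {n} → Graph n → ℕ → Set
IsDegeneracy G κ = Degenerate G κ × (∀ d → Degenerate G d → κ ℕ.≤ d)

record Match {n k} (G : Graph n) (H : Graph k) : Set where
  field
    S        : Subset n
    π        : ∃ (_∈ S) ↔ Fin k
    preserve : ∀ u v → Adj H (Inverse.to π u) (Inverse.to π v) →
               Adj G (proj₁ u) (proj₁ v)

record Automorphism {k} (H : Graph k) : Set where
  field
    perm      : Permutation′ k
    preserves : ∀ u v → Adj H u v ⇔ Adj H (perm ⟨$⟩ʳ u) (perm ⟨$⟩ʳ v)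

module _ {n k} {G : Graph n} {H : Graph k} where

  Equivalent : Match G H → Match G H → Set
  Equivalent M M′ = Match.S M ≡ Match.S M′ × Σ (Automorphism H) λ σ →
    ∀ v (p : v ∈ Match.S M) (p′ : v ∈ Match.S M′) →
      Inverse.to (Match.π M′) (v , p′) ≡
      Automorphism.perm σ ⟨$⟩ʳ Inverse.to (Match.π M) (v , p)

-- IsDM G H N says DM(G,H) = N: there is a system of exactly N
-- representatives for the equivalence classes of matches.
IsDM : ∀ {n k} → Graph n → Graph k → ℕ → Set
IsDM G H N = Σ (Fin N → Match G H) λ rep →
  (∀ i j → Equivalent (rep i) (rep j) → i ≡ j) ×
  (∀ M → ∃[ i ] Equivalent M (rep i))

-- Every edge occurs exactly once, in one of its two orientations.
record EdgeList {n} (G : Graph n) (es : List (Fin n × Fin n)) : Set where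
  field
    sound    : All (uncurry (Adj G)) es
    complete : ∀ u v → Adj G u v → (u , v) ∈ₗ es ⊎ (v , u) ∈ₗ es
    distinct : AllPairs (λ e e′ → e ≢ e′ × e ≢ swap e′) es

record Input : Set where
  field
    n         : ℕ
    graph     : Graph n
    connected : Connected graph
    edges     : List (Fin n × Fin n)
    isList    : EdgeList graph edges

  m : ℕ
  m = length edges

  contents : List ℕ
  contents = n ∷ m ∷ concatMap (λ (u , v) → toℕ u ∷ toℕ v ∷ []) edges

-- Registers are named by constants in the program; memory is addressed by
-- words.
Reg Label : Set
Reg   = ℕ
Label = ℕ

data Op : Set where
  add sub mul div mod and or xor shl shr eq lt : Op

data Instr : Set where
  const : Reg → ℕ → Instr
  arith : Op → Reg → Reg → Reg → Instr
  load  : Reg → Reg → Instr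
  store : Reg → Reg → Instr
  rand  : Reg → Instr
  jmp   : Label → Instr
  jz    : Reg → Label → Instr
  halt  : Instr

Program : Set
Program = List Instr

record State : Set where
  constructor ⟨_,_,_⟩
  field
    pc  : ℕ
    reg : ℕ → ℕ
    mem : ℕ → ℕ

open State public

_[_≔_] : (ℕ → ℕ) → ℕ → ℕ → ℕ → ℕ
(f [ a ≔ x ]) b = if a ℕ.≡ᵇ b then x else f b

bool : Bool → ℕ
bool b = if b then 1 else 0

bitwise : (Bool → Bool → Bool) → ℕ → ℕ → ℕ → ℕ
bitwise f zero    x y = 0
bitwise f (suc w) x y =
  bool (f (x %ℕ 2 ℕ.≡ᵇ 1) (y %ℕ 2 ℕ.≡ᵇ 1)) ℕ.+
  2 ℕ.* bitwise f w (x /ℕ 2) (y /ℕ 2)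

data Next : Set where
  halted : Next
  det    : State → Next
  random : (ℕ → State) → Next

module RAM (w : ℕ) where

  instance
    2^w≢0 : NonZero (2 ℕ.^ w)
    2^w≢0 = m^n≢0 2 w

  word : ℕ → ℕ
  word x = x %ℕ (2 ℕ.^ w)

  -- The result is reduced by word afterwards; division by zero gives 0.
  ⟦_⟧ : Op → ℕ → ℕ → ℕ
  ⟦ add ⟧ x y       = x ℕ.+ y
  ⟦ sub ⟧ x y       = (x ℕ.+ 2 ℕ.^ w) ℕ.∸ y
  ⟦ mul ⟧ x y       = x ℕ.* y
  ⟦ div ⟧ x zero    = 0
  ⟦ div ⟧ x (suc y) = x /ℕ suc y
  ⟦ mod ⟧ x zero    = 0
  ⟦ mod ⟧ x (suc y) = x %ℕ suc y
  ⟦ and ⟧ x y       = bitwise _∧_ w x y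
  ⟦ or  ⟧ x y       = bitwise _∨_ w x y
  ⟦ xor ⟧ x y       = bitwise _xor_ w x y
  ⟦ shl ⟧ x y       = x ℕ.* 2 ℕ.^ y
  ⟦ shr ⟧ x y       = _/ℕ_ x (2 ℕ.^ y) {{m^n≢0 2 y}}
  ⟦ eq  ⟧ x y       = bool (x ℕ.≡ᵇ y)
  ⟦ lt  ⟧ x y       = bool (x ℕ.<ᵇ y)

  exec : Instr → State → Next
  exec (const r x)     ⟨ i , R , M ⟩ = det ⟨ suc i , R [ r ≔ word x ] , M ⟩
  exec (arith o r a b) ⟨ i , R , M ⟩ =
    det ⟨ suc i , R [ r ≔ word (⟦ o ⟧ (R a) (R b)) ] , M ⟩
  exec (load r a)      ⟨ i , R , M ⟩ = det ⟨ suc i , R [ r ≔ M (R a) ] , M ⟩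
  exec (store a b)     ⟨ i , R , M ⟩ = det ⟨ suc i , R , M [ R a ≔ R b ] ⟩
  exec (rand r)        ⟨ i , R , M ⟩ =
    random λ x → ⟨ suc i , R [ r ≔ x ] , M ⟩
  exec (jmp l)         ⟨ i , R , M ⟩ = det ⟨ l , R , M ⟩
  exec (jz r l)        ⟨ i , R , M ⟩ =
    det ⟨ (if R r ℕ.≡ᵇ 0 then l else suc i) , R , M ⟩
  exec halt            s             = halted

  -- Leaving the program also halts.
  step : Program → State → Next
  step P s with head (drop (pc s) P)
  ... | just c  = exec c s
  ... | nothing = halted

  data _⊢_⟶_ (P : Program) (s : State) : State → Set where
    detStep  : ∀ {s′} → step P s ≡ det s′ → P ⊢ s ⟶ s′
    randStep : ∀ {g} (x : Fin (2 ℕ.^ w)) → step P s ≡ random g →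
               P ⊢ s ⟶ g (toℕ x)

  average : (Fin (2 ℕ.^ w) → ℚ) → ℚ
  average f = sum +-0-rawMonoid f * (+ 1 / (2 ℕ.^ w))

  -- The expectation of min(T, t), where T is the number of instructions
  -- executed from the given state until halting.  By monotone convergence
  -- E[T] is the supremum of these over t, so an upper bound on E[T] is an
  -- upper bound on all of them.
  truncatedTime : Program → ℕ → State → ℚ
  truncatedTime P zero    s = 0ℚ
  truncatedTime P (suc t) s with step P s
  ... | halted   = 0ℚ
  ... | det s′   = 1ℚ + truncatedTime P t s′
  ... | random g = 1ℚ + average (λ x → truncatedTime P t (g (toℕ x)))

  start : List ℕ → State
  start xs = ⟨ 0 , (λ _ → 0) , (λ a → word (fromMaybe 0 (head (drop a xs)))) ⟩

-- The word length on n-vertex inputs is wordFactor · (1 + ⌊log₂ n⌋); the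
-- constant hidden in O(log n) is chosen by the algorithm.
record Algorithm : Set where
  field
    wordFactor : ℕ
    program    : Program

module _ (A : Algorithm) (I : Input) where
  open Algorithm A
  open RAM (wordFactor ℕ.* suc ⌊log₂ Input.n I ⌋)

  expectedTime : ℕ → ℚ
  expectedTime t = truncatedTime program t (start (Input.contents I))

  -- Every finite run has positive probability, so never erring is a
  -- condition on all reachable halting states.  The output is register 0.
  NeverErrs : (ℕ → Set) → Set
  NeverErrs Answer = ∀ s → Star (program ⊢_⟶_) (start (Input.contents I)) s →
    step program s ≡ halted → Answer (reg s 0)

  FiniteExpectedTime : Set
  FiniteExpectedTime = ∃[ b ] ∀ t → expectedTime t ≤ b

Problem : Set₁
Problem = Input → ℕ → Set

LasVegas : Algorithm → Problem → Set
LasVegas A Answer = ∀ I → NeverErrs A I (Answer I) × FiniteExpectedTime A I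

TriangleDetection : Problem
TriangleDetection I out =
  (HasTriangle (Input.graph I) × out ≡ 1) ⊎
  (¬ HasTriangle (Input.graph I) × out ≡ 0)

SUBCNT : ∀ {k} → Graph k → Problem
SUBCNT H I out = IsDM (Input.graph I) H out

fromℕ : ℕ → ℚ
fromℕ n = + n / 1

_^ℚ_ : ℚ → ℕ → ℚ
_^ℚ_ = _^_ +-*-rawSemiring

-- For x, y ≥ 0 and γ = p/q > 0 this is x ≤ y · m^(1+γ), with both sides
-- raised to the power q.
_≤_·_^1+_ : ℚ → ℚ → ℕ → ℚ → Set
x ≤ y · m ^1+ γ = x ^ℚ q ≤ (y ^ℚ q) * fromℕ (m ℕ.^ (q ℕ.+ p))
  where
  p = absℤ (↥ γ)
  q = ↧ₙ γ

-- E[T] ≤ y · m^(1+γ) on the input I.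
RunsWithin : Algorithm → Input → ℚ → ℚ → Set
RunsWithin A I y γ = ∀ t → expectedTime A I t ≤ y · Input.m I ^1+ γ

TendsToZero : (ℕ → ℚ) → Set
TendsToZero h = ∀ ε → 0ℚ < ε → ∃[ M ] ∀ m → M ℕ.≤ m → h m < ε

-- Inputs without edges are exempt: there m^(1+γ) = 0, which no algorithm
-- that executes an instruction could meet.
LittleO : Algorithm → ℚ → (ℕ → ℕ) → Set
LittleO A γ f = ∃[ h ] (∀ m → 0ℚ ≤ h m) × TendsToZero h ×
  (∀ I κ → 1 ℕ.≤ Input.m I → IsDegeneracy (Input.graph I) κ →
    RunsWithin A I (h (Input.m I) * fromℕ (f κ)) γ)

-- The worst-case expected time over inputs with exactly m edges exceeds
-- c · m^(1+γ) for all large m.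
BigOmega : Algorithm → ℚ → Set
BigOmega A γ = ∃[ c ] 0ℚ < c × ∃[ M ] ∀ m → M ℕ.≤ m →
  ∃[ I ] Input.m I ≡ m × ¬ RunsWithin A I c γ

-- Restricting γ to rationals loses nothing: BigOmega A γ persists when γ
-- decreases, so a positive real exponent gives a positive rational one.
TriangleDetectionConjecture : Set
TriangleDetectionConjecture = ∃[ γ ] 0ℚ < γ ×
  (∀ A → LasVegas A TriangleDetection → BigOmega A γ)

{-# OPTIONS --safe #-}

-- Replace every edge of G by k − 5 parallel paths of length two. The
-- expanded graph is 2-degenerate and has O(m) edges, and the vertices of G
-- on any of its 6-cycles form a triangle of G. Let H be the triangle with
-- one side expanded in this way and the other two subdivided once: it
-- contains a 6-cycle, so it occurs in the expanded graph iff G has a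
-- triangle. As κ ≤ 2 there, counting H in time o(m^(1+γ) f(κ)) detects
-- triangles in time o(m^(1+γ)): write down the expanded graph in linear
-- time, run the counting program on it, and compare its output with 0.
-- The two inputs have different word lengths, so the detector uses longer
-- words than the program it runs and truncates after every instruction.

module Submission where

open import Defs
open import Algebra.Bundles using (CommutativeRing)
open import Algebra.Definitions.RawMonoid using (sum)
import Algebra.Properties.CommutativeSemiring.Exp as Exp
open import Data.Bool using (Bool; true; false; T; if_then_else_; _∧_; _∨_; _xor_)
open import Data.Bool.Properties using (T-∨)
open import Data.Empty using (⊥)
open import Data.Fin as Fin using (Fin; zero; suc; toℕ; fromℕ<; _↑ˡ_; _↑ʳ_; splitAt; combine; quotient; remainder)
open import Data.Fin.Patterns using (0F; 1F; 2F; 3F; 4F; 5F)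
import Data.Fin.Properties as Fin
open import Data.Fin.Subset using (Subset; Nonempty; _∈_; ∣_∣; _∪_; ⁅_⁆)
open import Data.Fin.Subset.Properties using (p⊆q⇒∣p∣≤∣q∣; ∣⁅x⁆∣≡1; x∈p∪q⁺; x∈⁅x⁆; _∈?_; Empty-unique; ∣⊥∣≡0)
import Data.Integer as ℤ
import Data.Integer.Properties as ℤ
open import Data.List using (List; []; _∷_; _++_; length; concat; concatMap; lookup; tabulate; head; drop)
open import Data.List.Membership.Propositional using () renaming (_∈_ to _∈ₗ_)
open import Data.List.Membership.Propositional.Properties using (∈-concat⁺′; ∈-tabulate⁺; ∈-lookup)
open import Data.List.Properties using (length-++)
open import Data.List.Relation.Unary.All as All using (All; []; _∷_)
import Data.List.Relation.Unary.All.Properties as All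
open import Data.List.Relation.Unary.AllPairs as AllPairs using (AllPairs; []; _∷_)
import Data.List.Relation.Unary.AllPairs.Properties as AllPairs
open import Data.List.Relation.Unary.Any as Any using (here; there)
open import Data.List.Relation.Unary.Any.Properties using (lookup-index)
open import Data.Maybe using (Maybe; just; nothing; fromMaybe)
open import Data.Nat as ℕ using (ℕ; zero; suc; NonZero; z≤n; s≤s)
open import Data.Nat.Divisibility using (_∣_; m∣m*n; n∣m*n)
open import Data.Nat.DivMod using (_/_; _%_; m/n≤m; m%n<n; m≡m%n+[m/n]*n; m<n⇒m%n≡m; m<n⇒m/n≡0; m<n*o⇒m/o<n; m*n/n≡m; m/n≡1+[m∸n]/n; +-distrib-/-∣ˡ; [m+n]%n≡m%n; [m+kn]%n≡m%n; m∣n⇒o%n%m≡o%m)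
open import Data.Nat.Induction using (<-rec)
open import Data.Nat.Logarithm using (⌊log₂_⌋; ⌊log₂⌋-mono-≤; ⌊log₂⌊n/2⌋⌋≡⌊log₂n⌋∸1)
import Data.Nat.Properties as ℕ
open import Data.Nat.Tactic.RingSolver using (solve-∀)
open import Data.Product using (Σ; ∃; ∃-syntax; _×_; _,_; proj₁; proj₂; swap; uncurry)
open import Data.Rational as ℚ using (ℚ; 0ℚ; 1ℚ; ↥_; ↧ₙ_; toℚᵘ)
open import Data.Rational.Base using (+-0-rawMonoid)
import Data.Rational.Properties as ℚ
import Data.Rational.Unnormalised as ℚᵘ
import Data.Rational.Unnormalised.Properties as ℚᵘ
open import Data.Sum using (_⊎_; inj₁; inj₂; [_,_]′)
open import Data.Unit using (tt)
open import Data.Vec using ([]; _∷_; here; there) renaming (tabulate to tabulateᵥ)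
open import Data.Vec.Properties using (lookup∘tabulate; []=⇒lookup; lookup⇒[]=)
open import Function using (_∘_; _$_; Equivalence; Inverse; Injective; mk↔ₛ′)
open import Relation.Binary.Construct.Closure.ReflexiveTransitive using (Star; ε; _◅_; _◅◅_; gmap)
open import Relation.Binary.PropositionalEquality
open import Relation.Nullary using (¬_; Dec; yes; no; contradiction)
open import Relation.Nullary.Decidable using (toWitness; fromWitness; isYes)

-- Subdividing makes the degeneracy a constant, so `f` enters only through `f 0`, `f 1` and `f 2`,
-- however fast it grows. The number of paths is forced by the vertex count of the pattern: three
-- corners, one midpoint on each of two sides and k - 5 on the third make k. Every edge of the graph
-- is expanded alike, since any of them may have to play the third side. Time and edge count change
-- only by factors depending on k, so the `γ` of the conjecture serves for all k.
--
-- The larger obstacle is the machine. The expanded input fixes a word length `w` of its own, and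
-- the counting program may depend on `w` through overflow, bit operations and random words. Words
-- of length `W` > `w` reproduce its behaviour because `2 ^ w` divides `2 ^ W`: on reduced operands
-- all operations agree after reduction, and a reduced uniform word is again uniform. Every
-- instruction becomes exactly two, so addresses double and the expected time at most doubles, up to
-- an additive constant.

module Graphs where
  open import Data.Nat using (_+_; _*_; _≤_)

  -- Subsets, and matches as injective homomorphisms.

  ∣p∪q∣≤∣p∣+∣q∣ : ∀ {n} (p q : Subset n) → ∣ p ∪ q ∣ ≤ ∣ p ∣ + ∣ q ∣
  ∣p∪q∣≤∣p∣+∣q∣ []          []          = z≤n
  ∣p∪q∣≤∣p∣+∣q∣ (true ∷ p)  (true ∷ q)  =
    s≤s (ℕ.≤-trans (∣p∪q∣≤∣p∣+∣q∣ p q) (ℕ.+-monoʳ-≤ ∣ p ∣ (ℕ.n≤1+n _)))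
  ∣p∪q∣≤∣p∣+∣q∣ (true ∷ p)  (false ∷ q) = s≤s (∣p∪q∣≤∣p∣+∣q∣ p q)
  ∣p∪q∣≤∣p∣+∣q∣ (false ∷ p) (true ∷ q)  =
    ℕ.≤-trans (s≤s (∣p∪q∣≤∣p∣+∣q∣ p q)) (ℕ.≤-reflexive (sym (ℕ.+-suc ∣ p ∣ ∣ q ∣)))
  ∣p∪q∣≤∣p∣+∣q∣ (false ∷ p) (false ∷ q) = ∣p∪q∣≤∣p∣+∣q∣ p q

  ∈-tabulate⁻ : ∀ {n} (f : Fin n → Bool) {v} → v ∈ tabulateᵥ f → T (f v)
  ∈-tabulate⁻ f {v} p = subst T (trans (sym ([]=⇒lookup p)) (lookup∘tabulate f v)) _

  ∈-tabulate⁺ᵥ : ∀ {n} (f : Fin n → Bool) {v} → T (f v) → v ∈ tabulateᵥ f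
  ∈-tabulate⁺ᵥ f {v} p = lookup⇒[]= v (tabulateᵥ f) (trans (lookup∘tabulate f v) (T⇒≡true p))
    where
    T⇒≡true : ∀ {b} → T b → b ≡ true
    T⇒≡true {true} _ = refl

  -- Makes two elements of the domain of a match equal as soon as their vertices are, which the
  -- inverse laws of `π` require.
  ∈-irrelevant : ∀ {n} {p : Subset n} {v} (q r : v ∈ p) → q ≡ r
  ∈-irrelevant here      here      = refl
  ∈-irrelevant (there q) (there r) = cong there (∈-irrelevant q r)

  Adj-sym : ∀ {n} (G : Graph n) {u v} → Adj G u v → Adj G v u
  Adj-sym G {u} {v} = subst T (Graph.symmetric G u v)

  Adj-irrefl : ∀ {n} (G : Graph n) {u v} → Adj G u v → u ≢ v
  Adj-irrefl G {u} uv refl = subst T (Graph.loopless G u) uv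

  module _ {n k} {G : Graph n} {H : Graph k} where

    -- The domain has to be a Boolean vector, so it is cut out by searching for a preimage; the
    -- inverse of `φ` is what the search finds, and injectivity makes it two-sided.
    embedding⇒match : (φ : Fin k → Fin n) → Injective _≡_ _≡_ φ →
      (∀ i j → Adj H i j → Adj G (φ i) (φ j)) → Match G H
    embedding⇒match φ φ-inj φ-adj = record
      { S        = S
      ; π        = mk↔ₛ′ to from to∘from from∘to
      ; preserve = λ u v uv →
          subst₂ (Adj G) (φ∘to u) (φ∘to v) (φ-adj (to u) (to v) uv)
      }
      where
      hit? : ∀ v → Dec (∃ λ i → φ i ≡ v)
      hit? v = Fin.any? λ i → φ i Fin.≟ v

      S : Subset n
      S = tabulateᵥ (isYes ∘ hit?)

      preimage : ∀ {v} → v ∈ S → ∃ λ i → φ i ≡ v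
      preimage {v} p = toWitness {a? = hit? v} (∈-tabulate⁻ (isYes ∘ hit?) p)

      to : ∃ (_∈ S) → Fin k
      to (v , p) = proj₁ (preimage p)

      φ∘to : ∀ u → φ (to u) ≡ proj₁ u
      φ∘to (v , p) = proj₂ (preimage p)

      from : Fin k → ∃ (_∈ S)
      from i = φ i , ∈-tabulate⁺ᵥ (isYes ∘ hit?) (fromWitness {a? = hit? (φ i)} (i , refl))

      to∘from : ∀ i → to (from i) ≡ i
      to∘from i = φ-inj (φ∘to (from i))

      from∘to : ∀ u → from (to u) ≡ u
      from∘to u@(v , p) = pair (φ∘to u)
        where
        pair : ∀ {x} {q : x ∈ S} → x ≡ v → (x , q) ≡ u
        pair refl = cong (v ,_) (∈-irrelevant _ _)

    match⇒embedding : Match G H → Σ (Fin k → Fin n) λ φ →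
      Injective _≡_ _≡_ φ × (∀ i j → Adj H i j → Adj G (φ i) (φ j))
    match⇒embedding M = φ , φ-inj , φ-adj
      where
      open Match M
      open Inverse π
      φ : Fin k → Fin n
      φ = proj₁ ∘ from

      pair : ∀ {u v : ∃ (_∈ S)} → proj₁ u ≡ proj₁ v → u ≡ v
      pair refl = cong (_ ,_) (∈-irrelevant _ _)

      φ-inj : Injective _≡_ _≡_ φ
      φ-inj {i} {j} e≡ = trans (sym (inverseˡ refl)) (trans (cong to (pair e≡)) (inverseˡ refl))

      φ-adj : ∀ i j → Adj H i j → Adj G (φ i) (φ j)
      φ-adj i j ij = preserve (from i) (from j)
        (subst₂ (Adj H) (sym (inverseˡ refl)) (sym (inverseˡ refl)) ij)

  -- Subdivisions of multigraphs and their hexagons.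

  rotate : Fin 6 → Fin 6
  rotate 0F = 1F
  rotate 1F = 2F
  rotate 2F = 3F
  rotate 3F = 4F
  rotate 4F = 5F
  rotate 5F = 0F

  -- Edges are indices with two ends rather than pairs of vertices, so that parallel edges are
  -- allowed: both the pattern and the expanded graph are subdivisions of multigraphs.
  module Subdivision {n M : ℕ} (end₁ end₂ : Fin M → Fin n) where

    incident : Fin n → Fin M → Bool
    incident v e = isYes (v Fin.≟ end₁ e) ∨ isYes (v Fin.≟ end₂ e)

    Incident : Fin n → Fin M → Set
    Incident v e = T (incident v e)

    incident⁻ : ∀ {v e} → Incident v e → v ≡ end₁ e ⊎ v ≡ end₂ e
    incident⁻ {v} {e} p with Equivalence.to (T-∨ {isYes (v Fin.≟ end₁ e)}) p
    ... | inj₁ q = inj₁ (toWitness {a? = v Fin.≟ end₁ e} q)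
    ... | inj₂ q = inj₂ (toWitness {a? = v Fin.≟ end₂ e} q)

    incident⁺ : ∀ {v e} → v ≡ end₁ e ⊎ v ≡ end₂ e → Incident v e
    incident⁺ {v} {e} (inj₁ q) =
      Equivalence.from (T-∨ {isYes (v Fin.≟ end₁ e)}) (inj₁ (fromWitness {a? = v Fin.≟ end₁ e} q))
    incident⁺ {v} {e} (inj₂ q) =
      Equivalence.from (T-∨ {isYes (v Fin.≟ end₁ e)}) (inj₂ (fromWitness {a? = v Fin.≟ end₂ e} q))

    link : Fin n ⊎ Fin M → Fin n ⊎ Fin M → Bool
    link (inj₁ v) (inj₂ e) = incident v e
    link (inj₂ e) (inj₁ v) = incident v e
    link _        _        = false

    link-sym : ∀ x y → link x y ≡ link y x
    link-sym (inj₁ _) (inj₁ _) = refl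
    link-sym (inj₁ _) (inj₂ _) = refl
    link-sym (inj₂ _) (inj₁ _) = refl
    link-sym (inj₂ _) (inj₂ _) = refl

    link-irrefl : ∀ x → link x x ≡ false
    link-irrefl (inj₁ _) = refl
    link-irrefl (inj₂ _) = refl

    subdivision : Graph (n + M)
    subdivision = record
      { adj       = λ u v → link (splitAt n u) (splitAt n v)
      ; symmetric = λ u v → link-sym (splitAt n u) (splitAt n v)
      ; loopless  = λ u → link-irrefl (splitAt n u)
      }

    old : Fin n → Fin (n + M)
    old v = v ↑ˡ M

    mid : Fin M → Fin (n + M)
    mid e = n ↑ʳ e

    data Kind : Fin (n + M) → Set where
      is-old : ∀ v → Kind (v ↑ˡ M)
      is-mid : ∀ e → Kind (n ↑ʳ e)

    kind : ∀ x → Kind x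
    kind x with splitAt n x in e≡
    ... | inj₁ v = subst Kind (Fin.splitAt⁻¹-↑ˡ e≡) (is-old v)
    ... | inj₂ e = subst Kind (Fin.splitAt⁻¹-↑ʳ e≡) (is-mid e)

    old-mid : ∀ v e → Graph.adj subdivision (old v) (mid e) ≡ incident v e
    old-mid v e rewrite Fin.splitAt-↑ˡ n v M | Fin.splitAt-↑ʳ n M e = refl

    old-mid⁺ : ∀ {v e} → Incident v e → Adj subdivision (old v) (mid e)
    old-mid⁺ {v} {e} = subst T (sym (old-mid v e))

    old-mid⁻ : ∀ {v e} → Adj subdivision (old v) (mid e) → Incident v e
    old-mid⁻ {v} {e} = subst T (old-mid v e)

    ¬old-old : ∀ {u v} → ¬ Adj subdivision (old u) (old v)
    ¬old-old {u} {v} p rewrite Fin.splitAt-↑ˡ n u M | Fin.splitAt-↑ˡ n v M = p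

    ¬mid-mid : ∀ {e f} → ¬ Adj subdivision (mid e) (mid f)
    ¬mid-mid {e} {f} p rewrite Fin.splitAt-↑ʳ n M e | Fin.splitAt-↑ʳ n M f = p

    old-injective : ∀ {u v} → old u ≡ old v → u ≡ v
    old-injective = Fin.↑ˡ-injective M _ _

    mid-injective : ∀ {e f} → mid e ≡ mid f → e ≡ f
    mid-injective = Fin.↑ʳ-injective n _ _

    old≢mid : ∀ {v e} → old v ≢ mid e
    old≢mid {v} {e} e≡ with trans (sym (Fin.splitAt-↑ˡ n v M))
      (trans (cong (splitAt n) e≡) (Fin.splitAt-↑ʳ n M e))
    ... | ()

    Joined : Fin n → Fin n → Set
    Joined u v = ∃ λ e → Incident u e × Incident v e

    subdivision-connected : .{{NonZero n}} → (∀ u v → Star Joined u v) → Connected subdivision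
    subdivision-connected joined = ℕ.≢-nonZero positive , path
      where
      positive : n + M ≢ 0
      positive e≡ = ℕ.≢-nonZero⁻¹ n (ℕ.m+n≡0⇒m≡0 n e≡)

      lift : ∀ {u v} → Star Joined u v → Star (Adj subdivision) (old u) (old v)
      lift ε = ε
      lift ((e , ue , ve) ◅ ps) =
        old-mid⁺ ue ◅ Adj-sym subdivision (old-mid⁺ ve) ◅ lift ps

      down : ∀ e → Adj subdivision (old (end₁ e)) (mid e)
      down e = old-mid⁺ (incident⁺ (inj₁ refl))

      path : ∀ x y → Star (Adj subdivision) x y
      path x y with kind x | kind y
      ... | is-old u | is-old v = lift (joined u v)
      ... | is-old u | is-mid f = lift (joined u (end₁ f)) ◅◅ down f ◅ ε
      ... | is-mid e | is-old v = Adj-sym subdivision (down e) ◅ lift (joined (end₁ e) v)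
      ... | is-mid e | is-mid f =
          Adj-sym subdivision (down e) ◅ lift (joined (end₁ e) (end₁ f)) ◅◅ down f ◅ ε

    -- A midpoint has at most the two ends of its edge as neighbours. A subgraph without midpoints
    -- consists of old vertices only, and these are pairwise non-adjacent, so any of its vertices
    -- has degree 0.
    subdivision-degenerate : Degenerate subdivision 2
    subdivision-degenerate F with Fin.any? (λ e → mid e ∈? Subgraph.vertices F)
    ... | yes (e , e∈F) =
        mid e , e∈F , ℕ.≤-trans (p⊆q⇒∣p∣≤∣q∣ {q = ⁅ old (end₁ e) ⁆ ∪ ⁅ old (end₂ e) ⁆} nbrs)
            (ℕ.≤-trans (∣p∪q∣≤∣p∣+∣q∣ ⁅ old (end₁ e) ⁆ ⁅ old (end₂ e) ⁆)
              (ℕ.≤-reflexive (cong₂ _+_ (∣⁅x⁆∣≡1 (old (end₁ e))) (∣⁅x⁆∣≡1 (old (end₂ e))))))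
      where
      nbrs : ∀ {x} → x ∈ tabulateᵥ (Subgraph.edge F (mid e)) →
        x ∈ ⁅ old (end₁ e) ⁆ ∪ ⁅ old (end₂ e) ⁆
      nbrs {x} p with kind x | Subgraph.edge⊆G F (mid e) x (∈-tabulate⁻ (Subgraph.edge F (mid e)) p)
      ... | is-mid f | q = contradiction q ¬mid-mid
      ... | is-old v | q with incident⁻ {v} {e} (old-mid⁻ (Adj-sym subdivision q))
      ... | inj₁ refl = x∈p∪q⁺ (inj₁ (x∈⁅x⁆ _))
      ... | inj₂ refl = x∈p∪q⁺ {p = ⁅ old (end₁ e) ⁆} (inj₂ (x∈⁅x⁆ _))
    ... | no ¬mid∈F with Subgraph.nonempty F
    ... | x , x∈F =
        x , x∈F , ℕ.≤-trans
          (ℕ.≤-reflexive (trans (cong ∣_∣ (Empty-unique none)) (∣⊥∣≡0 (n + M)))) z≤n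
      where
      open Subgraph F
      none : ¬ Nonempty (tabulateᵥ (edge x))
      none (y , p) with kind x | kind y | ∈-tabulate⁻ (edge x) p
      ... | is-mid e | _     | _ = ¬mid∈F (e , x∈F)
      ... | is-old u | is-old v | q = ¬old-old (edge⊆G _ _ q)
      ... | is-old u | is-mid e | q = ¬mid∈F (e , endpoint _ _ (subst T (symmetric _ _) q))

    module _ {G : Graph n} (sound : ∀ e → Adj G (end₁ e) (end₂ e)) where

      -- The middle vertex must be a midpoint, and a walk through it either turns back or arrives at
      -- the other end of the same edge; `old u ≢ z` excludes turning back.
      two-step : ∀ {u y z} → Adj subdivision (old u) y → Adj subdivision y z → old u ≢ z →
        ∃ λ v → z ≡ old v × Adj G u v
      two-step {u} {y} {z} uy yz u≢z with kind y | kind z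
      ... | is-old v | _     = contradiction uy ¬old-old
      ... | is-mid e | is-mid f = contradiction yz ¬mid-mid
      ... | is-mid e | is-old v =
          v , refl , adj (incident⁻ (old-mid⁻ uy)) (incident⁻ (old-mid⁻ (Adj-sym subdivision yz)))
        where
        adj : u ≡ end₁ e ⊎ u ≡ end₂ e → v ≡ end₁ e ⊎ v ≡ end₂ e → Adj G u v
        adj (inj₁ refl) (inj₁ refl) = contradiction refl u≢z
        adj (inj₁ refl) (inj₂ refl) = sound e
        adj (inj₂ refl) (inj₁ refl) = Adj-sym G (sound e)
        adj (inj₂ refl) (inj₂ refl) = contradiction refl u≢z

      -- The even positions become the corners of the triangle, hence the three inequalities. The
      -- starting vertex is a parameter because the cycle has to be read from an old vertex.
      HasHexagon : Fin (n + M) → Set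
      HasHexagon x₀ = ∃[ x₁ ] ∃[ x₂ ] ∃[ x₃ ] ∃[ x₄ ] ∃[ x₅ ]
        (x₀ ⇿ x₁ × x₁ ⇿ x₂ × x₂ ⇿ x₃ × x₃ ⇿ x₄ × x₄ ⇿ x₅ × x₅ ⇿ x₀) ×
        (x₀ ≢ x₂ × x₂ ≢ x₄ × x₄ ≢ x₀)
        where
        _⇿_ = Adj subdivision

      hexagon⇒triangle : ∀ {u} → HasHexagon (old u) → HasTriangle G
      hexagon⇒triangle {u} (_ , _ , _ , _ , _ , (a , b , c , d , e , f) , (0≢2 , 2≢4 , 4≢0))
        with two-step a b 0≢2
      ... | v , refl , uv with two-step c d 2≢4
      ... | w , refl , vw with two-step e f 4≢0
      ... | u′ , e≡ , wu = u , v , w , uv , vw ,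
        Adj-sym G (subst (Adj G w) (sym (old-injective e≡)) wu)

      -- No two midpoints are adjacent, so one of the first two vertices of the cycle is old;
      -- reading starts there.
      embedded-hexagon⇒triangle : ∀ (x : Fin 6 → Fin (n + M)) → Injective _≡_ _≡_ x →
        (∀ i → Adj subdivision (x i) (x (rotate i))) → HasTriangle G
      embedded-hexagon⇒triangle x x-inj a = by-kind (x 0F) (x 1F) refl refl
        where
        -- Fresh variables with equations, since matching on `kind` must unify its index, which
        -- fails for the applied terms `x 0F` and `x 1F`.
        by-kind : ∀ y z → y ≡ x 0F → z ≡ x 1F → HasTriangle G
        by-kind y z y≡ z≡ with kind y | kind z
        ... | is-old u | _     = hexagon⇒triangle {u} (subst HasHexagon (sym y≡)
          (x 1F , x 2F , x 3F , x 4F , x 5F , (a 0F , a 1F , a 2F , a 3F , a 4F , a 5F) ,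
           ((λ ()) ∘ x-inj , (λ ()) ∘ x-inj , (λ ()) ∘ x-inj)))
        ... | is-mid e | is-old v = hexagon⇒triangle {v} (subst HasHexagon (sym z≡)
          (x 2F , x 3F , x 4F , x 5F , x 0F , (a 1F , a 2F , a 3F , a 4F , a 5F , a 0F) ,
           ((λ ()) ∘ x-inj , (λ ()) ∘ x-inj , (λ ()) ∘ x-inj)))
        ... | is-mid e | is-mid f = contradiction
          (subst₂ (Adj subdivision) (sym y≡) (sym z≡) (a 0F)) ¬mid-mid

  -- The pattern graph.

  module Pattern (t : ℕ) where

    -- The triangle with edges 12, 20, and 01 taken 1 + t times.
    end₁ end₂ : Fin (3 + t) → Fin 3
    end₁ 0F            = 1F
    end₁ 1F            = 2F
    end₁ (suc (suc _)) = 0F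
    end₂ 0F            = 2F
    end₂ 1F            = 0F
    end₂ (suc (suc _)) = 1F

    open Subdivision end₁ end₂ public

    pattern-graph : Graph (6 + t)
    pattern-graph = subdivision

    pattern-connected : Connected pattern-graph
    pattern-connected = subdivision-connected joined
      where
      joined : ∀ u v → Star Joined u v
      joined 0F 0F = ε
      joined 0F 1F = (2F , tt , tt) ◅ ε
      joined 0F 2F = (1F , tt , tt) ◅ ε
      joined 1F 0F = (2F , tt , tt) ◅ ε
      joined 1F 1F = ε
      joined 1F 2F = (0F , tt , tt) ◅ ε
      joined 2F 0F = (1F , tt , tt) ◅ ε
      joined 2F 1F = (0F , tt , tt) ◅ ε
      joined 2F 2F = ε

    -- Vertices 0, 1, 2 are the corners; 3, 4 and 5 are the midpoints of 12, of 20 and of the first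
    -- copy of 01.
    hexagon : Fin 6 → Fin (6 + t)
    hexagon 0F = 0F
    hexagon 1F = 5F
    hexagon 2F = 1F
    hexagon 3F = 3F
    hexagon 4F = 2F
    hexagon 5F = 4F

    hexagon-injective : Injective _≡_ _≡_ hexagon
    hexagon-injective p = trans (sym (back-hexagon _)) (trans (cong back p) (back-hexagon _))
      where
      back : Fin (6 + t) → Fin 6
      back 0F = 0F
      back 1F = 2F
      back 2F = 4F
      back 3F = 3F
      back 4F = 5F
      back (suc (suc (suc (suc (suc _))))) = 1F

      back-hexagon : ∀ i → back (hexagon i) ≡ i
      back-hexagon 0F = refl
      back-hexagon 1F = refl
      back-hexagon 2F = refl
      back-hexagon 3F = refl
      back-hexagon 4F = refl
      back-hexagon 5F = refl

    hexagon-adjacent : ∀ i → Adj pattern-graph (hexagon i) (hexagon (rotate i))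
    hexagon-adjacent 0F = tt
    hexagon-adjacent 1F = tt
    hexagon-adjacent 2F = tt
    hexagon-adjacent 3F = tt
    hexagon-adjacent 4F = tt
    hexagon-adjacent 5F = tt

  module Embedding {n m n′ m′} (a₁ a₂ : Fin m → Fin n) (b₁ b₂ : Fin m′ → Fin n′) where
    private
      module A = Subdivision a₁ a₂
      module B = Subdivision b₁ b₂

    -- Corners go to corners and midpoints to midpoints. The hypothesis speaks of incidence rather
    -- than of first and second ends, so an edge may be mapped with its orientation reversed.
    subdivision-embedding : (f : Fin n → Fin n′) (g : Fin m → Fin m′) →
      Injective _≡_ _≡_ f → Injective _≡_ _≡_ g →
      (∀ e → B.Incident (f (a₁ e)) (g e) × B.Incident (f (a₂ e)) (g e)) →
      Match B.subdivision A.subdivision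
    subdivision-embedding f g f-inj g-inj inc = embedding⇒match φ φ-inj φ-adj
      where
      φ : Fin (n + m) → Fin (n′ + m′)
      φ x = [ B.old ∘ f , B.mid ∘ g ]′ (splitAt n x)

      φ-old : ∀ v → φ (A.old v) ≡ B.old (f v)
      φ-old v rewrite Fin.splitAt-↑ˡ n v m = refl

      φ-mid : ∀ e → φ (A.mid e) ≡ B.mid (g e)
      φ-mid e rewrite Fin.splitAt-↑ʳ n m e = refl

      φ-inj : Injective _≡_ _≡_ φ
      φ-inj {x} {y} p with A.kind x | A.kind y
      ... | A.is-old u | A.is-old v =
          cong A.old (f-inj (B.old-injective (trans (sym (φ-old u)) (trans p (φ-old v)))))
      ... | A.is-old u | A.is-mid e =
          contradiction (trans (sym (φ-old u)) (trans p (φ-mid e))) B.old≢mid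
      ... | A.is-mid e | A.is-old v =
          contradiction (trans (sym (φ-old v)) (trans (sym p) (φ-mid e))) B.old≢mid
      ... | A.is-mid e | A.is-mid f =
          cong A.mid (g-inj (B.mid-injective (trans (sym (φ-mid e)) (trans p (φ-mid f)))))

      incident : ∀ {v} e → A.Incident v e → B.Incident (f v) (g e)
      incident {v} e ve with A.incident⁻ {v} {e} ve
      ... | inj₁ refl = proj₁ (inc e)
      ... | inj₂ refl = proj₂ (inc e)

      old-mid : ∀ v e → Adj A.subdivision (A.old v) (A.mid e) →
        Adj B.subdivision (φ (A.old v)) (φ (A.mid e))
      old-mid v e ve = subst₂ (Adj B.subdivision) (sym (φ-old v)) (sym (φ-mid e))
        (B.old-mid⁺ (incident e (A.old-mid⁻ ve)))

      φ-adj : ∀ x y → Adj A.subdivision x y → Adj B.subdivision (φ x) (φ y)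
      φ-adj x y xy with A.kind x | A.kind y
      ... | A.is-old u | A.is-old v = contradiction xy A.¬old-old
      ... | A.is-old u | A.is-mid e = old-mid u e xy
      ... | A.is-mid e | A.is-old v = Adj-sym B.subdivision (old-mid v e (Adj-sym A.subdivision xy))
      ... | A.is-mid e | A.is-mid f = contradiction xy A.¬mid-mid

  -- The expanded graph and its edge list.

  module EdgeIndex {n} (G : Graph n) (es : List (Fin n × Fin n)) (list : EdgeList G es) where
    open EdgeList list

    e₁ e₂ : Fin (length es) → Fin n
    e₁ i = proj₁ (lookup es i)
    e₂ i = proj₂ (lookup es i)

    edge-sound : ∀ i → Adj G (e₁ i) (e₂ i)
    edge-sound i = All.lookup sound (∈-lookup {xs = es} i)

    Joins : Fin (length es) → Fin n → Fin n → Set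
    Joins i u v = (u ≡ e₁ i ⊎ u ≡ e₂ i) × (v ≡ e₁ i ⊎ v ≡ e₂ i)

    edge-index : ∀ {u v} → Adj G u v → ∃ λ i → Joins i u v
    edge-index {u} {v} uv with complete u v uv
    ... | inj₁ p =
        Any.index p , inj₁ (cong proj₁ (lookup-index p)) , inj₂ (cong proj₂ (lookup-index p))
    ... | inj₂ p =
        Any.index p , inj₂ (cong proj₂ (lookup-index p)) , inj₁ (cong proj₁ (lookup-index p))

    -- An edge joins at most two vertices, so distinct sides of a triangle have distinct indices.
    third : ∀ {i u v w} → Joins i u v → w ≡ e₁ i ⊎ w ≡ e₂ i → u ≢ v → w ≢ u → w ≢ v → ⊥
    third (inj₁ p , inj₁ q) r        u≢v _   _   = u≢v (trans p (sym q))
    third (inj₂ p , inj₂ q) r        u≢v _   _   = u≢v (trans p (sym q))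
    third (inj₁ p , inj₂ q) (inj₁ r) _   w≢u _   = w≢u (trans r (sym p))
    third (inj₁ p , inj₂ q) (inj₂ r) _   _   w≢v = w≢v (trans r (sym q))
    third (inj₂ p , inj₁ q) (inj₁ r) _   _   w≢v = w≢v (trans r (sym q))
    third (inj₂ p , inj₁ q) (inj₂ r) _   w≢u _   = w≢u (trans r (sym p))

  module Reduction (t : ℕ) {n} (G : Graph n) (es : List (Fin n × Fin n))
    (list : EdgeList G es) where
    open EdgeIndex G es list

    m : ℕ
    m = length es

    M : ℕ
    M = m * suc t

    -- An index codes an original edge together with the number of a copy; `quotient` forgets the
    -- copy. This order of the copies is also the one in which the detector writes them.
    end₁ end₂ : Fin M → Fin n
    end₁ e = e₁ (quotient (suc t) e)
    end₂ e = e₂ (quotient (suc t) e)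

    open Subdivision end₁ end₂

    reduced : Graph (n + M)
    reduced = subdivision

    copy : Fin m → Fin (suc t) → Fin M
    copy = combine

    copy-incident : ∀ {i u} j → u ≡ e₁ i ⊎ u ≡ e₂ i → Incident u (copy i j)
    copy-incident {i} j p = incident⁺ (subst (λ k → _ ≡ e₁ k ⊎ _ ≡ e₂ k)
      (sym (cong proj₁ (Fin.remQuot-combine {k = suc t} i j))) p)

    end-sound : ∀ e → Adj G (end₁ e) (end₂ e)
    end-sound e = edge-sound (quotient (suc t) e)

    reduced-connected : Connected G → Connected reduced
    reduced-connected (n≢0 , path) = subdivision-connected {{n≢0}} λ u v →
      gmap (λ x → x) joined (path u v)
      where
      joined : ∀ {u v} → Adj G u v → Joined u v
      joined uv with edge-index uv
      ... | i , p , q = copy i 0F , copy-incident 0F p , copy-incident 0F q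

    match⇒triangle : Match reduced (Pattern.pattern-graph t) → HasTriangle G
    match⇒triangle μ with match⇒embedding μ
    ... | φ , φ-inj , φ-adj =
        embedded-hexagon⇒triangle {G = G} end-sound (φ ∘ hexagon) (hexagon-injective ∘ φ-inj)
      (λ i → φ-adj _ _ (hexagon-adjacent i))
      where open Pattern t using (hexagon; hexagon-injective; hexagon-adjacent)

    -- Sides bc and ac use one copy each, while ab uses all `suc t` copies for the multiple side of
    -- the pattern. The three sides have different edge indices, so their copies never clash.
    triangle⇒match : HasTriangle G → Match reduced (Pattern.pattern-graph t)
    triangle⇒match (a , b , c , ab , bc , ac) = subdivision-embedding f g f-inj g-inj inc
      where
      module P = Pattern t
      open Embedding P.end₁ P.end₂ end₁ end₂
      a≢b = Adj-irrefl G ab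
      b≢c = Adj-irrefl G bc
      a≢c = Adj-irrefl G ac

      f : Fin 3 → Fin n
      f 0F = a
      f 1F = b
      f 2F = c

      f-inj : Injective _≡_ _≡_ f
      f-inj {0F} {0F} p = refl
      f-inj {0F} {1F} p = contradiction p a≢b
      f-inj {0F} {2F} p = contradiction p a≢c
      f-inj {1F} {0F} p = contradiction (sym p) a≢b
      f-inj {1F} {1F} p = refl
      f-inj {1F} {2F} p = contradiction p b≢c
      f-inj {2F} {0F} p = contradiction (sym p) a≢c
      f-inj {2F} {1F} p = contradiction (sym p) b≢c
      f-inj {2F} {2F} p = refl

      iab = edge-index ab
      ibc = edge-index bc
      iac = edge-index ac

      g : Fin (3 + t) → Fin M
      g 0F            = copy (proj₁ ibc) 0F
      g 1F            = copy (proj₁ iac) 0F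
      g (suc (suc j)) = copy (proj₁ iab) j

      same : ∀ {i j : Fin m} {k l} → copy i k ≡ copy j l → i ≡ j
      same {i} {j} {k} {l} = Fin.combine-injectiveˡ i k j l

      ¬bc=ac : proj₁ ibc ≢ proj₁ iac
      ¬bc=ac p =
        third (proj₂ ibc)
          (subst (λ k → a ≡ e₁ k ⊎ a ≡ e₂ k) (sym p) (proj₁ (proj₂ iac))) b≢c a≢b a≢c
      ¬bc=ab : proj₁ ibc ≢ proj₁ iab
      ¬bc=ab p =
        third (proj₂ ibc)
          (subst (λ k → a ≡ e₁ k ⊎ a ≡ e₂ k) (sym p) (proj₁ (proj₂ iab))) b≢c a≢b a≢c
      ¬ac=ab : proj₁ iac ≢ proj₁ iab
      ¬ac=ab p =
        third (proj₂ iac) (subst (λ k → b ≡ e₁ k ⊎ b ≡ e₂ k) (sym p) (proj₂ (proj₂ iab))) a≢c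
          (a≢b ∘ sym) b≢c

      g-inj : Injective _≡_ _≡_ g
      g-inj {0F}          {0F}          p = refl
      g-inj {0F}          {1F}          p = contradiction (same p) ¬bc=ac
      g-inj {0F}          {suc (suc j)} p = contradiction (same p) ¬bc=ab
      g-inj {1F}          {0F}          p = contradiction (sym (same p)) ¬bc=ac
      g-inj {1F}          {1F}          p = refl
      g-inj {1F}          {suc (suc j)} p = contradiction (same p) ¬ac=ab
      g-inj {suc (suc i)} {0F}          p = contradiction (sym (same p)) ¬bc=ab
      g-inj {suc (suc i)} {1F}          p = contradiction (sym (same p)) ¬ac=ab
      g-inj {suc (suc i)} {suc (suc j)} p =
        cong (λ k → suc (suc k)) (Fin.combine-injectiveʳ (proj₁ iab) i (proj₁ iab) j p)

      inc : ∀ e → Incident (f (P.end₁ e)) (g e) × Incident (f (P.end₂ e)) (g e)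
      inc 0F            =
        copy-incident 0F (proj₁ (proj₂ ibc)) , copy-incident 0F (proj₂ (proj₂ ibc))
      inc 1F            =
        copy-incident 0F (proj₂ (proj₂ iac)) , copy-incident 0F (proj₁ (proj₂ iac))
      inc (suc (suc j)) = copy-incident j (proj₁ (proj₂ iab)) , copy-incident j (proj₂ (proj₂ iab))

    halves : Fin M → List (Fin (n + M) × Fin (n + M))
    halves e = (old (end₁ e) , mid e) ∷ (old (end₂ e) , mid e) ∷ []

    reduced-edges : List (Fin (n + M) × Fin (n + M))
    reduced-edges = concat (tabulate halves)

    -- Each pair is written with its old vertex first, so agreeing with a swapped pair would
    -- identify an old vertex with a midpoint. The two halves of one edge differ in their old ends
    -- because `G` is loopless, halves of different edges in their midpoints.
    reduced-list : EdgeList reduced reduced-edges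
    reduced-list = record
      { sound    = All.concat⁺ (All.tabulate⁺ halves-sound)
      ; complete = complete
      ; distinct = AllPairs.concat⁺ (All.tabulate⁺ within)
          (AllPairs.tabulate⁺ λ e≢f → across e≢f ∷ across e≢f ∷ [])
      }
      where
      halves-sound : ∀ e → All (uncurry (Adj reduced)) (halves e)
      halves-sound e =
        old-mid⁺ (incident⁺ {end₁ e} {e} (inj₁ refl)) ∷ old-mid⁺
          (incident⁺ {end₂ e} {e} (inj₂ refl)) ∷ []

      occurs : ∀ v e → Incident v e → (old v , mid e) ∈ₗ reduced-edges
      occurs v e ve with incident⁻ {v} {e} ve
      ... | inj₁ refl = ∈-concat⁺′ (here refl) (∈-tabulate⁺ {f = halves} e)
      ... | inj₂ refl = ∈-concat⁺′ (there (here refl)) (∈-tabulate⁺ {f = halves} e)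

      complete : ∀ x y → Adj reduced x y → (x , y) ∈ₗ reduced-edges ⊎ (y , x) ∈ₗ reduced-edges
      complete x y xy with kind x | kind y
      ... | is-old u | is-old v = contradiction xy ¬old-old
      ... | is-old u | is-mid e = inj₁ (occurs u e (old-mid⁻ xy))
      ... | is-mid e | is-old v = inj₂ (occurs v e (old-mid⁻ (Adj-sym reduced xy)))
      ... | is-mid e | is-mid f = contradiction xy ¬mid-mid

      Distinct : Fin (n + M) × Fin (n + M) → Fin (n + M) × Fin (n + M) → Set
      Distinct e e′ = e ≢ e′ × e ≢ swap e′

      within : ∀ e → AllPairs Distinct (halves e)
      within e = (((λ p → Adj-irrefl G (end-sound e) (old-injective (cong proj₁ p))) ,
                   (λ p → old≢mid (cong proj₁ p))) ∷ []) ∷ [] ∷ []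

      across : ∀ {e f u} → e ≢ f → All (Distinct (old u , mid e)) (halves f)
      across e≢f = (e≢f ∘ mid-injective ∘ cong proj₂ , old≢mid ∘ cong proj₁) ∷
                   (e≢f ∘ mid-injective ∘ cong proj₂ , old≢mid ∘ cong proj₁) ∷ []

    length-reduced : length reduced-edges ≡ M * 2
    length-reduced = length-concat halves (λ _ → refl)
      where
      length-concat : ∀ {A : Set} {k c} (h : Fin k → List A) → (∀ i → length (h i) ≡ c) →
        length (concat (tabulate h)) ≡ k * c
      length-concat {k = zero}  h p = refl
      length-concat {k = suc k} h p =
        trans (length-++ (h 0F)) (cong₂ _+_ (p 0F) (length-concat (h ∘ suc) (p ∘ suc)))

  -- Bounds between the numbers of vertices and edges.

  lookup-injective : ∀ {A : Set} {xs : List A} → AllPairs _≢_ xs → Injective _≡_ _≡_ (lookup xs)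
  lookup-injective (_ ∷ _)  {zero}  {zero}  p = refl
  lookup-injective (x≢ ∷ _) {zero}  {suc j} p = contradiction p (All.lookup x≢ (∈-lookup j))
  lookup-injective (x≢ ∷ _) {suc i} {zero}  p = contradiction (sym p) (All.lookup x≢ (∈-lookup i))
  lookup-injective (_ ∷ u)  {suc i} {suc j} p = cong suc (lookup-injective u p)

  module EdgeCount {n} (G : Graph n) (es : List (Fin n × Fin n)) (list : EdgeList G es) where
    open EdgeIndex G es list

    -- Keeps the logarithm of the expanded size within a constant factor of that of `n`, as the word
    -- length of the detector requires.
    edges≤n*n : length es ≤ n * n
    edges≤n*n = Fin.injective⇒≤ {f = code} code-inj
      where
      code : Fin (length es) → Fin (n * n)
      code i = combine (e₁ i) (e₂ i)

      code-inj : Injective _≡_ _≡_ code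
      code-inj {i} {j} p with Fin.combine-injective (e₁ i) (e₂ i) (e₁ j) (e₂ j) p
      ... | q , r = lookup-injective (AllPairs.map proj₁ (EdgeList.distinct list)) (cong₂ _,_ q r)

  -- In a connected graph with at least two vertices every vertex has an edge, so the vertices
  -- inject into the edge ends. The extra 1 covers the graph with a single vertex. This makes time
  -- linear in `n` also linear in the number of edges.
  n≤1+edges*2 : ∀ {n} (G : Graph n) es → EdgeList G es → Connected G → n ≤ 1 + length es * 2
  n≤1+edges*2 {zero}        G es list c = z≤n
  n≤1+edges*2 {suc zero}    G es list c = s≤s z≤n
  n≤1+edges*2 {suc (suc n)} G es list (_ , path) = ℕ.m≤n⇒m≤1+n (Fin.injective⇒≤ {f = code} code-inj)
    where
    open EdgeIndex G es list

    neighbour : ∀ v → ∃ λ w → Adj G v w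
    neighbour v = first (path v (other v)) (v≢other v)
      where
      other : Fin (suc (suc n)) → Fin (suc (suc n))
      other 0F      = 1F
      other (suc _) = 0F

      v≢other : ∀ v → v ≢ other v
      v≢other 0F      ()
      v≢other (suc _) ()

      first : ∀ {u v} → Star (Adj G) u v → u ≢ v → ∃ λ w → Adj G u w
      first ε        u≢v = contradiction refl u≢v
      first (uw ◅ _) _   = _ , uw

    end : Fin (length es) → Fin 2 → Fin (suc (suc n))
    end i 0F = e₁ i
    end i 1F = e₂ i

    place : ∀ v → ∃ λ i → ∃ λ s → end i s ≡ v
    place v with edge-index (proj₂ (neighbour v))
    ... | i , inj₁ p , _ = i , 0F , sym p
    ... | i , inj₂ p , _ = i , 1F , sym p

    code : Fin (suc (suc n)) → Fin (length es * 2)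
    code v = combine (proj₁ (place v)) (proj₁ (proj₂ (place v)))

    code-inj : Injective _≡_ _≡_ code
    code-inj {u} {v} p with place u | place v
    ... | i , s , refl | j , r , refl with Fin.combine-injective i s j r p
    ... | refl , refl = refl

  -- The layout of both inputs in memory.

  _at_ : List ℕ → ℕ → ℕ
  xs at a = fromMaybe 0 (head (drop a xs))

  flatten : ∀ {n} → List (Fin n × Fin n) → List ℕ
  flatten = concatMap (λ (u , v) → toℕ u ∷ toℕ v ∷ [])

  []-at : ∀ a → [] at a ≡ 0
  []-at zero    = refl
  []-at (suc a) = refl

  flatten-at₁ : ∀ {n} (es : List (Fin n × Fin n)) i →
    flatten es at (toℕ i * 2) ≡ toℕ (proj₁ (lookup es i))
  flatten-at₁ (e ∷ es) zero    = refl
  flatten-at₁ (e ∷ es) (suc i) = flatten-at₁ es i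

  flatten-at₂ : ∀ {n} (es : List (Fin n × Fin n)) i →
    flatten es at (1 + toℕ i * 2) ≡ toℕ (proj₂ (lookup es i))
  flatten-at₂ (e ∷ es) zero    = refl
  flatten-at₂ (e ∷ es) (suc i) = flatten-at₂ es i

  flatten-beyond : ∀ {n} (es : List (Fin n × Fin n)) a → length es * 2 ≤ a → flatten es at a ≡ 0
  flatten-beyond []       a             p             = []-at a
  flatten-beyond (e ∷ es) (suc (suc a)) (s≤s (s≤s p)) = flatten-beyond es a p

  -- Links the coding of copies to the `div` instruction by which the detector recovers the original
  -- edge.
  toℕ-quotient : ∀ {m} t (x : Fin (m * suc t)) → toℕ (quotient (suc t) x) ≡ toℕ x / suc t
  toℕ-quotient {m} t x = begin
    toℕ q                                             ≡⟨ m*n/n≡m (toℕ q) (suc t) ⟨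
    toℕ q * suc t / suc t                             ≡⟨ ℕ.+-identityʳ _ ⟨
    toℕ q * suc t / suc t + 0
      ≡⟨ cong (toℕ q * suc t / suc t +_) (m<n⇒m/n≡0 (Fin.toℕ<n r)) ⟨
    toℕ q * suc t / suc t + toℕ r / suc t
      ≡⟨ +-distrib-/-∣ˡ {toℕ q * suc t} (toℕ r) {suc t} (n∣m*n (toℕ q)) ⟨
    (toℕ q * suc t + toℕ r) / suc t
      ≡⟨ cong (λ y → (y + toℕ r) / suc t) (ℕ.*-comm (toℕ q) (suc t)) ⟩
    (suc t * toℕ q + toℕ r) / suc t                   ≡⟨ cong (_/ suc t) (Fin.toℕ-combine q r) ⟨
    toℕ (combine q r) / suc t
      ≡⟨ cong (λ y → toℕ y / suc t) (Fin.combine-remQuot {m} (suc t) x) ⟩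
    toℕ x / suc t                                     ∎
    where
    open ≡-Reasoning
    q = quotient {m} (suc t) x
    r = remainder {m} (suc t) x

  module ReducedInput (t : ℕ) (I : Input) where
    open Input I using (n; graph; edges; isList; connected)
    open EdgeIndex graph edges isList using (e₁; e₂)
    open Reduction t graph edges isList public
    open Subdivision end₁ end₂ using (old; mid)

    input : Input
    input = record
      { n         = n + M
      ; graph     = reduced
      ; connected = reduced-connected connected
      ; edges     = reduced-edges
      ; isList    = reduced-list
      }

    src dst : ℕ → ℕ
    src a = Input.contents I at a
    dst a = Input.contents input at a

    chunk : ∀ {k n} → (Fin k → List (Fin n × Fin n)) → List ℕ
    chunk h = flatten (concat (tabulate h))

    chunk-at : ∀ {k n} (u v x : Fin k → Fin n) s →
      let xs = chunk (λ e → (u e , x e) ∷ (v e , x e) ∷ []) in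
      xs at (0 + toℕ s * 4) ≡ toℕ (u s) × xs at (1 + toℕ s * 4) ≡ toℕ (x s) ×
      xs at (2 + toℕ s * 4) ≡ toℕ (v s) × xs at (3 + toℕ s * 4) ≡ toℕ (x s)
    chunk-at u v x zero    = refl , refl , refl , refl
    chunk-at u v x (suc s) = chunk-at (u ∘ suc) (v ∘ suc) (x ∘ suc) s

    dst-0 : dst 0 ≡ n + M
    dst-0 = refl

    dst-1 : dst 1 ≡ M * 2
    dst-1 = length-reduced

    -- The original input is no longer than the expanded one, so beyond the cells to be written
    -- memory is 0 already and nothing has to be cleared.
    src-fits : ∀ a → 2 + M * 4 ≤ a → src a ≡ 0
    src-fits (suc (suc a)) (s≤s (s≤s p)) = flatten-beyond edges a
      (ℕ.≤-trans (ℕ.*-monoˡ-≤ 2 (ℕ.m≤m*n m (suc t)))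
        (ℕ.≤-trans (ℕ.*-monoʳ-≤ M {2} {4} (s≤s (s≤s z≤n))) p))

    dst-fits : ∀ a → 2 + M * 4 ≤ a → dst a ≡ 0
    dst-fits (suc (suc a)) (s≤s (s≤s p)) = flatten-beyond reduced-edges a
      (ℕ.≤-trans (ℕ.≤-reflexive (trans (cong (_* 2) length-reduced) (ℕ.*-assoc M 2 2))) p)

    module _ (s : Fin M) where
      private
        p = chunk-at (old ∘ end₁) (old ∘ end₂) mid s
        q = quotient {m} (suc t) s

      dst-end₁ : dst (2 + toℕ s * 4) ≡ src (2 + toℕ s / suc t * 2)
      dst-end₁ = trans (proj₁ p) (trans (Fin.toℕ-↑ˡ (end₁ s) M) (trans (sym (flatten-at₁ edges q))
        (cong (λ i → src (2 + i * 2)) (toℕ-quotient {m} t s))))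

      dst-mid₁ : dst (3 + toℕ s * 4) ≡ n + toℕ s
      dst-mid₁ = trans (proj₁ (proj₂ p)) (Fin.toℕ-↑ʳ n s)

      dst-end₂ : dst (4 + toℕ s * 4) ≡ src (3 + toℕ s / suc t * 2)
      dst-end₂ =
        trans (proj₁ (proj₂ (proj₂ p)))
          (trans (Fin.toℕ-↑ˡ (end₂ s) M) (trans (sym (flatten-at₂ edges q))
        (cong (λ i → src (3 + i * 2)) (toℕ-quotient {m} t s))))

      dst-mid₂ : dst (5 + toℕ s * 4) ≡ n + toℕ s
      dst-mid₂ = trans (proj₂ (proj₂ (proj₂ p))) (Fin.toℕ-↑ʳ n s)

-- Arithmetic of rationals.

module Machines where
  open import Data.Rational using (_+_; _*_; _≤_; _<_)

  -- `fromℕ` normalises by a gcd that does not compute on a variable, so its laws are proved for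
  -- unnormalised rationals and pulled back along `toℚᵘ`.
  toℚᵘ-fromℕ : ∀ n → toℚᵘ (fromℕ n) ℚᵘ.≃ ℚᵘ.mkℚᵘ (ℤ.+ n) 0
  toℚᵘ-fromℕ n = ℚ.toℚᵘ-fromℚᵘ (ℚᵘ.mkℚᵘ (ℤ.+ n) 0)

  fromℕ-+ : ∀ m n → fromℕ (m ℕ.+ n) ≡ fromℕ m + fromℕ n
  fromℕ-+ m n = ℚ.toℚᵘ-injective (begin
    toℚᵘ (fromℕ (m ℕ.+ n))                ≈⟨ toℚᵘ-fromℕ (m ℕ.+ n) ⟩
    ℚᵘ.mkℚᵘ (ℤ.+ (m ℕ.+ n)) 0
      ≈⟨ ℚᵘ.*≡*
        (cong (ℤ._* ℤ.+ 1) (sym (cong₂ ℤ._+_ (ℤ.*-identityʳ (ℤ.+ m)) (ℤ.*-identityʳ (ℤ.+ n))))) ⟩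
    ℚᵘ.mkℚᵘ (ℤ.+ m) 0 ℚᵘ.+ ℚᵘ.mkℚᵘ (ℤ.+ n) 0  ≈⟨ ℚᵘ.+-cong (toℚᵘ-fromℕ m) (toℚᵘ-fromℕ n) ⟨
    toℚᵘ (fromℕ m) ℚᵘ.+ toℚᵘ (fromℕ n)    ≈⟨ ℚ.toℚᵘ-homo-+ (fromℕ m) (fromℕ n) ⟨
    toℚᵘ (fromℕ m + fromℕ n)              ∎)
    where open ℚᵘ.≃-Reasoning

  fromℕ-* : ∀ m n → fromℕ (m ℕ.* n) ≡ fromℕ m * fromℕ n
  fromℕ-* m n = ℚ.toℚᵘ-injective (begin
    toℚᵘ (fromℕ (m ℕ.* n))                ≈⟨ toℚᵘ-fromℕ (m ℕ.* n) ⟩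
    ℚᵘ.mkℚᵘ (ℤ.+ (m ℕ.* n)) 0               ≈⟨ ℚᵘ.*≡* (cong (ℤ._* ℤ.+ 1) (ℤ.pos-* m n)) ⟩
    ℚᵘ.mkℚᵘ (ℤ.+ m) 0 ℚᵘ.* ℚᵘ.mkℚᵘ (ℤ.+ n) 0  ≈⟨ ℚᵘ.*-cong (toℚᵘ-fromℕ m) (toℚᵘ-fromℕ n) ⟨
    toℚᵘ (fromℕ m) ℚᵘ.* toℚᵘ (fromℕ n)    ≈⟨ ℚ.toℚᵘ-homo-* (fromℕ m) (fromℕ n) ⟨
    toℚᵘ (fromℕ m * fromℕ n)              ∎)
    where open ℚᵘ.≃-Reasoning

  fromℕ-mono-≤ : ∀ {m n} → m ℕ.≤ n → fromℕ m ≤ fromℕ n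
  fromℕ-mono-≤ {m} {n} m≤n = ℚ.toℚᵘ-cancel-≤ (begin
    toℚᵘ (fromℕ m)   ≃⟨ toℚᵘ-fromℕ m ⟩
    ℚᵘ.mkℚᵘ (ℤ.+ m) 0  ≤⟨ ℚᵘ.*≤* (ℤ.*-monoʳ-≤-nonNeg (ℤ.+ 1) (ℤ.+≤+ m≤n)) ⟩
    ℚᵘ.mkℚᵘ (ℤ.+ n) 0  ≃⟨ toℚᵘ-fromℕ n ⟨
    toℚᵘ (fromℕ n)   ∎)
    where open ℚᵘ.≤-Reasoning

  0≤fromℕ : ∀ n → 0ℚ ≤ fromℕ n
  0≤fromℕ n = fromℕ-mono-≤ {0} {n} ℕ.z≤n

  fromℕ-suc : ∀ n → fromℕ (suc n) ≡ 1ℚ + fromℕ n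
  fromℕ-suc = fromℕ-+ 1

  unit : (n : ℕ) .{{_ : NonZero n}} → ℚ
  unit n = ℤ.+ 1 ℚ./ n

  fromℕ*unit : ∀ n .{{_ : NonZero n}} → fromℕ n * unit n ≡ 1ℚ
  fromℕ*unit (suc n) = ℚ.toℚᵘ-injective (begin
    toℚᵘ (fromℕ (suc n) * unit (suc n))          ≈⟨ ℚ.toℚᵘ-homo-* (fromℕ (suc n)) (unit (suc n)) ⟩
    toℚᵘ (fromℕ (suc n)) ℚᵘ.* toℚᵘ (unit (suc n))
      ≈⟨ ℚᵘ.*-cong (toℚᵘ-fromℕ (suc n)) (ℚ.toℚᵘ-fromℚᵘ (ℚᵘ.mkℚᵘ (ℤ.+ 1) n)) ⟩
    ℚᵘ.mkℚᵘ (ℤ.+ suc n) 0 ℚᵘ.* ℚᵘ.mkℚᵘ (ℤ.+ 1) n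
      ≈⟨ ℚᵘ.*≡*
        (cong (λ x → ℤ.+ suc x)
          (trans (trans (ℕ.*-identityʳ (n ℕ.* 1)) (ℕ.*-identityʳ n))
            (sym (trans (ℕ.+-identityʳ (n ℕ.+ 0)) (ℕ.+-identityʳ n))))) ⟩
    toℚᵘ 1ℚ                                      ∎)
    where open ℚᵘ.≃-Reasoning

  0≤unit : ∀ n .{{_ : NonZero n}} → 0ℚ ≤ unit n
  0≤unit n = ℚ.nonNegative⁻¹ (unit n) {{ℚ.normalize-nonNeg 1 n}}

  0<unit : ∀ n .{{_ : NonZero n}} → 0ℚ < unit n
  0<unit n = ℚ.positive⁻¹ (unit n) {{ℚ.normalize-pos 1 n}}

  *-mono-≤ : ∀ {p q r s} → 0ℚ ≤ p → 0ℚ ≤ s → p ≤ q → r ≤ s → p * r ≤ q * s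
  *-mono-≤ {p} {q} {r} {s} 0≤p 0≤s p≤q r≤s = ℚ.≤-trans
    (ℚ.*-monoˡ-≤-nonNeg p {{ℚ.nonNegative 0≤p}} r≤s)
    (ℚ.*-monoʳ-≤-nonNeg s {{ℚ.nonNegative 0≤s}} p≤q)

  0≤* : ∀ {p q} → 0ℚ ≤ p → 0ℚ ≤ q → 0ℚ ≤ p * q
  0≤* {p} {q} 0≤p 0≤q =
    subst (_≤ p * q) (ℚ.*-zeroʳ p) (ℚ.*-monoˡ-≤-nonNeg p {{ℚ.nonNegative 0≤p}} 0≤q)

  0≤+ : ∀ {p q} → 0ℚ ≤ p → 0ℚ ≤ q → 0ℚ ≤ p + q
  0≤+ = ℚ.+-mono-≤

  unit-* : ∀ k n .{{_ : NonZero n}} .{{_ : NonZero (k ℕ.* n)}} → fromℕ k * unit (k ℕ.* n) ≡ unit n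
  unit-* k n = begin
    fromℕ k * unit (k ℕ.* n)                          ≡⟨ ℚ.*-identityˡ _ ⟨
    1ℚ * (fromℕ k * unit (k ℕ.* n))
      ≡⟨ cong (_* (fromℕ k * unit (k ℕ.* n))) (trans (ℚ.*-comm (unit n) (fromℕ n)) (fromℕ*unit n)) ⟨
    unit n * fromℕ n * (fromℕ k * unit (k ℕ.* n))     ≡⟨ ℚ.*-assoc (unit n) (fromℕ n) _ ⟩
    unit n * (fromℕ n * (fromℕ k * unit (k ℕ.* n)))
      ≡⟨ cong (unit n *_) (ℚ.*-assoc (fromℕ n) (fromℕ k) _) ⟨
    unit n * (fromℕ n * fromℕ k * unit (k ℕ.* n))
      ≡⟨ cong (λ x → unit n * (x * unit (k ℕ.* n)))
        (trans (ℚ.*-comm (fromℕ n) (fromℕ k)) (sym (fromℕ-* k n))) ⟩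
    unit n * (fromℕ (k ℕ.* n) * unit (k ℕ.* n))       ≡⟨ cong (unit n *_) (fromℕ*unit (k ℕ.* n)) ⟩
    unit n * 1ℚ                                       ≡⟨ ℚ.*-identityʳ _ ⟩
    unit n                                            ∎
    where open ≡-Reasoning

  -- Finite sums and averages.

  Σ< : ℕ → (ℕ → ℚ) → ℚ
  Σ< n F = sum +-0-rawMonoid {n} (F ∘ toℕ)

  Σ<-mono : ∀ n {F G : ℕ → ℚ} → (∀ x → x ℕ.< n → F x ≤ G x) → Σ< n F ≤ Σ< n G
  Σ<-mono zero    F≤G = ℚ.≤-refl
  Σ<-mono (suc n) F≤G =
    ℚ.+-mono-≤ (F≤G 0 (ℕ.s≤s ℕ.z≤n)) (Σ<-mono n λ x x<n → F≤G (suc x) (ℕ.s≤s x<n))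

  Σ<-cong : ∀ n {F G : ℕ → ℚ} → (∀ x → x ℕ.< n → F x ≡ G x) → Σ< n F ≡ Σ< n G
  Σ<-cong zero    F≡G = refl
  Σ<-cong (suc n) F≡G =
    cong₂ _+_ (F≡G 0 (ℕ.s≤s ℕ.z≤n)) (Σ<-cong n λ x x<n → F≡G (suc x) (ℕ.s≤s x<n))

  Σ<-affine : ∀ n a b (F : ℕ → ℚ) → Σ< n (λ x → a + b * F x) ≡ fromℕ n * a + b * Σ< n F
  Σ<-affine zero a b F = sym (trans (cong₂ _+_ (ℚ.*-zeroˡ a) (ℚ.*-zeroʳ b)) (ℚ.+-identityˡ 0ℚ))
  Σ<-affine (suc n) a b F = begin
    a + b * F 0 + Σ< n (λ x → a + b * F (suc x))
      ≡⟨ cong (a + b * F 0 +_) (Σ<-affine n a b (F ∘ suc)) ⟩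
    a + b * F 0 + (fromℕ n * a + b * Σ< n (F ∘ suc))
      ≡⟨ interchange a (b * F 0) (fromℕ n * a) (b * Σ< n (F ∘ suc)) ⟩
    a + fromℕ n * a + (b * F 0 + b * Σ< n (F ∘ suc))
      ≡⟨ cong₂ _+_ head′ (sym (ℚ.*-distribˡ-+ b (F 0) (Σ< n (F ∘ suc)))) ⟩
    fromℕ (suc n) * a + b * (F 0 + Σ< n (F ∘ suc))          ∎
    where
    open ≡-Reasoning
    head′ : a + fromℕ n * a ≡ fromℕ (suc n) * a
    head′ = trans (cong (_+ fromℕ n * a) (sym (ℚ.*-identityˡ a)))
      (trans (sym (ℚ.*-distribʳ-+ a 1ℚ (fromℕ n))) (cong (_* a) (sym (fromℕ-suc n))))
    interchange : ∀ p q r s → p + q + (r + s) ≡ p + r + (q + s)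
    interchange p q r s = trans (ℚ.+-assoc p q (r + s)) (trans (cong (p +_)
      (trans (sym (ℚ.+-assoc q r s)) (trans (cong (_+ s) (ℚ.+-comm q r)) (ℚ.+-assoc r q s))))
        (sym (ℚ.+-assoc p r (q + s))))

  Σ<-+ : ∀ m n (F : ℕ → ℚ) → Σ< (m ℕ.+ n) F ≡ Σ< m F + Σ< n (λ x → F (m ℕ.+ x))
  Σ<-+ zero    n F = sym (ℚ.+-identityˡ _)
  Σ<-+ (suc m) n F = trans (cong (F 0 +_) (Σ<-+ m n (F ∘ suc))) (sym (ℚ.+-assoc (F 0) _ _))

  Σ<-periodic : ∀ k n .{{_ : NonZero n}} (F : ℕ → ℚ) →
    Σ< (k ℕ.* n) (λ x → F (x % n)) ≡ fromℕ k * Σ< n F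
  Σ<-periodic zero    n F = sym (ℚ.*-zeroˡ (Σ< n F))
  Σ<-periodic (suc k) n F = begin
    Σ< (n ℕ.+ k ℕ.* n) (λ x → F (x % n))
      ≡⟨ Σ<-+ n (k ℕ.* n) (λ x → F (x % n)) ⟩
    Σ< n (λ x → F (x % n)) + Σ< (k ℕ.* n) (λ x → F ((n ℕ.+ x) % n))
      ≡⟨ cong₂ _+_ (Σ<-cong n λ x x<n → cong F (m<n⇒m%n≡m x<n))
           (Σ<-cong (k ℕ.* n) λ x _ → cong F
             (trans (cong (_% n) (ℕ.+-comm n x)) ([m+n]%n≡m%n x n))) ⟩
    Σ< n F + Σ< (k ℕ.* n) (λ x → F (x % n))
      ≡⟨ cong₂ _+_ (sym (ℚ.*-identityˡ (Σ< n F))) (Σ<-periodic k n F) ⟩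
    1ℚ * Σ< n F + fromℕ k * Σ< n F
      ≡⟨ ℚ.*-distribʳ-+ (Σ< n F) 1ℚ (fromℕ k) ⟨
    (1ℚ + fromℕ k) * Σ< n F
      ≡⟨ cong (_* Σ< n F) (sym (fromℕ-suc k)) ⟩
    fromℕ (suc k) * Σ< n F                                            ∎
    where open ≡-Reasoning

  -- Taken over functions on ℕ instead of `Fin n`, so that an argument can be reduced by `_% n`; at
  -- `2 ^ w` it unfolds to `average`.
  mean : (n : ℕ) .{{_ : NonZero n}} → (ℕ → ℚ) → ℚ
  mean n F = Σ< n F * unit n

  mean-mono : ∀ n .{{_ : NonZero n}} {F G : ℕ → ℚ} → (∀ x → x ℕ.< n → F x ≤ G x) →
    mean n F ≤ mean n G
  mean-mono n F≤G = ℚ.*-monoʳ-≤-nonNeg (unit n) {{ℚ.nonNegative (0≤unit n)}} (Σ<-mono n F≤G)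

  mean-affine : ∀ n .{{_ : NonZero n}} a b (F : ℕ → ℚ) →
    mean n (λ x → a + b * F x) ≡ a + b * mean n F
  mean-affine n a b F = begin
    Σ< n (λ x → a + b * F x) * unit n                    ≡⟨ cong (_* unit n) (Σ<-affine n a b F) ⟩
    (fromℕ n * a + b * Σ< n F) * unit n
      ≡⟨ ℚ.*-distribʳ-+ (unit n) (fromℕ n * a) (b * Σ< n F) ⟩
    fromℕ n * a * unit n + b * Σ< n F * unit n
      ≡⟨ cong₂ _+_ (trans (cong (_* unit n) (ℚ.*-comm (fromℕ n) a))
           (trans (ℚ.*-assoc a (fromℕ n) (unit n))
             (trans (cong (a *_) (fromℕ*unit n)) (ℚ.*-identityʳ a))))
           (ℚ.*-assoc b (Σ< n F) (unit n)) ⟩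
    a + b * (Σ< n F * unit n)                            ∎
    where open ≡-Reasoning

  mean-periodic : ∀ k n .{{_ : NonZero n}} .{{_ : NonZero (k ℕ.* n)}} (F : ℕ → ℚ) →
    mean (k ℕ.* n) (λ x → F (x % n)) ≡ mean n F
  mean-periodic k n F = begin
    Σ< (k ℕ.* n) (λ x → F (x % n)) * unit (k ℕ.* n)
      ≡⟨ cong (_* unit (k ℕ.* n)) (trans (Σ<-periodic k n F) (ℚ.*-comm (fromℕ k) _)) ⟩
    Σ< n F * fromℕ k * unit (k ℕ.* n)                ≡⟨ ℚ.*-assoc (Σ< n F) (fromℕ k) _ ⟩
    Σ< n F * (fromℕ k * unit (k ℕ.* n))              ≡⟨ cong (Σ< n F *_) (unit-* k n) ⟩
    Σ< n F * unit n                                  ∎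
    where open ≡-Reasoning

  mean-nonNeg : ∀ n .{{_ : NonZero n}} {F : ℕ → ℚ} → (∀ x → 0ℚ ≤ F x) → 0ℚ ≤ mean n F
  mean-nonNeg n {F} 0≤F = 0≤* (Σ<-nonNeg n F 0≤F) (0≤unit n)
    where
    Σ<-nonNeg : ∀ n F → (∀ x → 0ℚ ≤ F x) → 0ℚ ≤ Σ< n F
    Σ<-nonNeg zero    F 0≤F = ℚ.≤-refl
    Σ<-nonNeg (suc n) F 0≤F = 0≤+ (0≤F 0) (Σ<-nonNeg n (F ∘ suc) (0≤F ∘ suc))

  -- Correctness and expected time of runs.

  module Runs (w : ℕ) where
    open RAM w

    fetch : Program → ℕ → Maybe Instr
    fetch P i = head (drop i P)

    step-fetch : ∀ P {s c} → fetch P (pc s) ≡ just c → step P s ≡ exec c s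
    step-fetch P {s} p with head (drop (pc s) P) | p
    ... | _ | refl = refl

    step-end : ∀ P {s} → fetch P (pc s) ≡ nothing → step P s ≡ halted
    step-end P {s} p with head (drop (pc s) P) | p
    ... | _ | refl = refl

    time-halted : ∀ P t {s} → step P s ≡ halted → truncatedTime P t s ≡ 0ℚ
    time-halted P zero        p = refl
    time-halted P (suc t) {s} p with step P s | p
    ... | _ | refl = refl

    time-det : ∀ P t {s s′} → step P s ≡ det s′ →
      truncatedTime P (suc t) s ≡ 1ℚ + truncatedTime P t s′
    time-det P t {s} p with step P s | p
    ... | _ | refl = refl

    time-random : ∀ P t {s g} → step P s ≡ random g →
      truncatedTime P (suc t) s ≡ 1ℚ + mean (2 ℕ.^ w) (λ x → truncatedTime P t (g x))
    time-random P t {s} p with step P s | p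
    ... | _ | refl = refl

    time-nonNeg : ∀ P t s → 0ℚ ≤ truncatedTime P t s
    time-nonNeg P zero    s = ℚ.≤-refl
    time-nonNeg P (suc t) s with step P s
    ... | halted   = ℚ.≤-refl
    ... | det s′   = 0≤+ (0≤fromℕ 1) (time-nonNeg P t s′)
    ... | random g = 0≤+ (0≤fromℕ 1) (mean-nonNeg (2 ℕ.^ w) λ x → time-nonNeg P t (g x))

    Correct : Program → (ℕ → Set) → State → Set
    Correct P Ans s = ∀ s′ → Star (P ⊢_⟶_) s s′ → step P s′ ≡ halted → Ans (reg s′ 0)

    -- `k` pays for the instructions of a known initial stretch and `B` for the rest, as a function
    -- of the truncation. Monotonicity of `B` lets an instruction be put in front, which shifts the
    -- truncation by one.
    record Runs (P : Program) (Ans : ℕ → Set) (B : ℕ → ℚ) (k : ℕ) (s : State) : Set where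
      field
        correct  : Correct P Ans s
        time     : ∀ t → truncatedTime P t s ≤ fromℕ k + B t
        monotone : ∀ t → B t ≤ B (suc t)

    open Runs public

    correct-det : ∀ {P Ans s s′} → step P s ≡ det s′ → Correct P Ans s′ → Correct P Ans s
    correct-det p c s″ ε                   h = contradiction (trans (sym p) h) λ ()
    correct-det p c s″ (detStep q ◅ r)     h with trans (sym p) q
    ... | refl = c s″ r h
    correct-det p c s″ (randStep x q ◅ r)  h = contradiction (trans (sym p) q) λ ()

    runs-det : ∀ {P Ans B k s s′} → step P s ≡ det s′ → Runs P Ans B k s′ → Runs P Ans B (suc k) s
    runs-det {P} {Ans} {B} {k} {s} {s′} p r = record
      { correct  = correct-det {P} {Ans} {s} p (correct r)
      ; monotone = monotone r
      ; time     = λ where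
          zero    → ℚ.≤-trans (time r 0) (ℚ.+-monoˡ-≤ (B 0) (fromℕ-mono-≤ (ℕ.n≤1+n k)))
          (suc t) → begin
            truncatedTime P (suc t) s    ≡⟨ time-det P t {s} p ⟩
            1ℚ + truncatedTime P t s′    ≤⟨ ℚ.+-monoʳ-≤ 1ℚ (time r t) ⟩
            1ℚ + (fromℕ k + B t)         ≡⟨ ℚ.+-assoc 1ℚ (fromℕ k) (B t) ⟨
            1ℚ + fromℕ k + B t           ≡⟨ cong (_+ B t) (sym (fromℕ-suc k)) ⟩
            fromℕ (suc k) + B t          ≤⟨ ℚ.+-monoʳ-≤ (fromℕ (suc k)) (monotone r t) ⟩
            fromℕ (suc k) + B (suc t)    ∎
      }
      where open ℚ.≤-Reasoning

    time-mono : ∀ P {t t′} s → t ℕ.≤ t′ → truncatedTime P t s ≤ truncatedTime P t′ s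
    time-mono P {t′ = t′} s ℕ.z≤n = time-nonNeg P t′ s
    time-mono P s (ℕ.s≤s t≤t′) with step P s
    ... | halted   = ℚ.≤-refl
    ... | det s′   = ℚ.+-monoʳ-≤ 1ℚ (time-mono P s′ t≤t′)
    ... | random g = ℚ.+-monoʳ-≤ 1ℚ (mean-mono (2 ℕ.^ w) λ x _ → time-mono P (g x) t≤t′)

-- Updates and truncated words.

module Detector where
  open Graphs
  open Machines
  open import Data.Nat using (_+_; _*_; _^_; _≤_; _<_; _∸_; _⊓_; _≡ᵇ_; _<ᵇ_; ⌊_/2⌋)

  ≡ᵇ-refl : ∀ n → (n ≡ᵇ n) ≡ true
  ≡ᵇ-refl zero    = refl
  ≡ᵇ-refl (suc n) = ≡ᵇ-refl n

  update-here : ∀ (f : ℕ → ℕ) a x → (f [ a ≔ x ]) a ≡ x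
  update-here f a x rewrite ≡ᵇ-refl a = refl

  -- `ι` is `sim` for registers and the identity for memory.
  update-cong : ∀ {f g : ℕ → ℕ} {x y} (ι : ℕ → ℕ) a → (∀ b → (ι a ≡ᵇ ι b) ≡ (a ≡ᵇ b)) →
    (∀ b → f (ι b) ≡ g b) → x ≡ y → ∀ b → (f [ ι a ≔ x ]) (ι b) ≡ (g [ a ≔ y ]) b
  update-cong ι a inj f≡g x≡y b rewrite inj b with a ≡ᵇ b
  ... | true  = x≡y
  ... | false = f≡g b

  update-all : ∀ {f : ℕ → ℕ} {x} (Q : ℕ → Set) a → (∀ b → Q (f b)) → Q x → ∀ b → Q ((f [ a ≔ x ]) b)
  update-all Q a Qf Qx b with a ≡ᵇ b
  ... | true  = Qx
  ... | false = Qf b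

  update-update : ∀ (f : ℕ → ℕ) a x y b → ((f [ a ≔ x ]) [ a ≔ y ]) b ≡ (f [ a ≔ y ]) b
  update-update f a x y b with a ≡ᵇ b
  ... | true  = refl
  ... | false = refl

  -- The low `w` digits of the result do not depend on how many more are computed; the further
  -- digits add a multiple of `2 ^ w`.
  bitwise-truncate : ∀ f w d x y → ∃ λ c → bitwise f (w + d) x y ≡ bitwise f w x y + c * 2 ^ w
  bitwise-truncate f zero    d x y = bitwise f d x y , sym (ℕ.*-identityʳ _)
  bitwise-truncate f (suc w) d x y with bitwise-truncate f w d (x / 2) (y / 2)
  ... | c , p = c , trans (cong (λ z → bool (f (x % 2 ≡ᵇ 1) (y % 2 ≡ᵇ 1)) + 2 * z) p)
                          (shift (bool (f (x % 2 ≡ᵇ 1) (y % 2 ≡ᵇ 1)))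
                            (bitwise f w (x / 2) (y / 2)) c (2 ^ w))
    where
    shift : ∀ b B c p → b + 2 * (B + c * p) ≡ b + 2 * B + c * (2 * p)
    shift = solve-∀

  -- By recursion rather than as `2 * n`, so that one more simulated instruction exposes two
  -- successors, both in program addresses and in truncation times.
  dbl : ℕ → ℕ
  dbl zero    = zero
  dbl (suc n) = suc (suc (dbl n))

  n≤dbl : ∀ n → n ≤ dbl n
  n≤dbl zero    = z≤n
  n≤dbl (suc n) = s≤s (ℕ.m≤n⇒m≤1+n (n≤dbl n))

  -- The simulated program's register r is register 16 + r; register 8 holds
  -- 2 ^ w, and reducing by it after each instruction truncates to w bits.
  sim : ℕ → ℕ
  sim r = 16 + r

  truncate : ℕ → Instr
  truncate r = arith mod (sim r) (sim r) 8

  -- Overwrites register 1, which is scratch during the simulation.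
  nop : Instr
  nop = arith add 1 0 0

  -- Register 0 is kept at 0 up to this point, so it serves both as the constant to compare with and
  -- as the output.
  verdict : Instr
  verdict = arith lt 0 0 (sim 0)

  -- Translating and simulating the counting program.

  module Translation (base len : ℕ) where

    -- Leaving a program halts it, so every target past the end is clamped to the address of
    -- `verdict`.
    label : ℕ → ℕ
    label l = base + dbl (l ⊓ len)

    -- Padding with `nop` gives every instruction length two, so that addresses simply double. A
    -- truncation follows exactly when a register of the simulated program was written.
    first second : Instr → Instr
    first (const r x)     = const (sim r) x
    first (arith o r a b) = arith o (sim r) (sim a) (sim b)
    first (load r a)      = load (sim r) (sim a)
    first (store a b)     = store (sim a) (sim b)
    first (rand r)        = rand (sim r)
    first (jmp l)         = nop
    first (jz r l)        = nop
    first halt            = jmp (label len)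
    second (const r x)     = truncate r
    second (arith o r a b) = truncate r
    second (load r a)      = truncate r
    second (store a b)     = nop
    second (rand r)        = truncate r
    second (jmp l)         = jmp (label l)
    second (jz r l)        = jz (sim r) (label l)
    second halt            = nop

    translate : Program → Program
    translate []      = verdict ∷ []
    translate (c ∷ P) = first c ∷ second c ∷ translate P

  -- At least one extra bit, because the modulus `2 ^ w` must itself fit in a word.
  module Simulation (w d : ℕ) (pre P : Program) where
    private
      W = w + suc d
      module p = RAM w
      module q = RAM W
      module P = Runs w
      module Q = Runs W

    open Translation (length pre) (length P)

    code : Program
    code = pre ++ translate P

    2^W : 2 ^ W ≡ 2 ^ suc d * 2 ^ w
    2^W = trans (ℕ.^-distribˡ-+-* 2 w (suc d)) (ℕ.*-comm (2 ^ w) (2 ^ suc d))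

    2^w∣2^W : 2 ^ w ∣ 2 ^ W
    2^w∣2^W = subst (2 ^ w ∣_) (sym (ℕ.^-distribˡ-+-* 2 w (suc d))) (m∣m*n (2 ^ suc d))

    2^w<2^W : 2 ^ w < 2 ^ W
    2^w<2^W = ℕ.^-monoʳ-< 2 (s≤s (s≤s z≤n)) (ℕ.m<m+n w (s≤s z≤n))

    word-word : ∀ x → p.word (q.word x) ≡ p.word x
    word-word x = m∣n⇒o%n%m≡o%m (2 ^ w) (2 ^ W) x {{p.2^w≢0}} {{q.2^w≢0}} 2^w∣2^W

    word< : ∀ x → p.word x < 2 ^ w
    word< x = m%n<n x (2 ^ w) {{p.2^w≢0}}

    word-id : ∀ {x} → x < 2 ^ w → p.word x ≡ x
    word-id = m<n⇒m%n≡m {{p.2^w≢0}}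

    word-idW : ∀ {x} → x < 2 ^ w → q.word x ≡ x
    word-idW x< = m<n⇒m%n≡m {{q.2^w≢0}} (ℕ.<-trans x< 2^w<2^W)

    mod-nonZero : ∀ x y .{{_ : NonZero y}} → q.⟦ mod ⟧ x y ≡ x % y
    mod-nonZero x (suc y) = refl

    truncated : ∀ x → q.word (q.⟦ mod ⟧ x (2 ^ w)) ≡ p.word x
    truncated x = trans (cong q.word (mod-nonZero x (2 ^ w) {{p.2^w≢0}})) (word-idW (word< x))

    word-+k : ∀ x k → p.word (x + k * 2 ^ w) ≡ p.word x
    word-+k x k = [m+kn]%n≡m%n x k (2 ^ w) {{p.2^w≢0}}

    bitwise-op : ∀ f x y → p.word (bitwise f W x y) ≡ p.word (bitwise f w x y)
    bitwise-op f x y with bitwise-truncate f w (suc d) x y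
    ... | c , e = trans (cong p.word e) (word-+k _ c)

    -- Most operations give the same natural number before reduction. `sub` adds `2 ^ W` in place of
    -- `2 ^ w`, a difference divisible by `2 ^ w`; the bound on `y` keeps its monus from cutting off
    -- at 0. The bit operations differ in digits above the first `w`.
    op-truncate : ∀ o {x y} → x < 2 ^ w → y < 2 ^ w → p.word (q.⟦ o ⟧ x y) ≡ p.word (p.⟦ o ⟧ x y)
    op-truncate add _ _ = refl
    op-truncate sub {x} {y} _ y< =
      trans (cong p.word shift) (word-+k (x + 2 ^ w ∸ y) (2 ^ suc d ∸ 1))
      where
      open ≡-Reasoning
      shift : x + 2 ^ W ∸ y ≡ x + 2 ^ w ∸ y + (2 ^ suc d ∸ 1) * 2 ^ w
      shift = begin
        x + 2 ^ W ∸ y                                   ≡⟨ cong (λ z → x + z ∸ y) 2^W ⟩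
        x + 2 ^ suc d * 2 ^ w ∸ y
          ≡⟨ cong (λ z → x + z * 2 ^ w ∸ y) (ℕ.m+[n∸m]≡n (ℕ.m^n>0 2 (suc d))) ⟨
        x + (2 ^ w + (2 ^ suc d ∸ 1) * 2 ^ w) ∸ y       ≡⟨ cong (_∸ y) (ℕ.+-assoc x (2 ^ w) _) ⟨
        x + 2 ^ w + (2 ^ suc d ∸ 1) * 2 ^ w ∸ y         ≡⟨ cong (_∸ y) (ℕ.+-comm (x + 2 ^ w) _) ⟩
        (2 ^ suc d ∸ 1) * 2 ^ w + (x + 2 ^ w) ∸ y
          ≡⟨ ℕ.+-∸-assoc ((2 ^ suc d ∸ 1) * 2 ^ w) (ℕ.≤-trans (ℕ.<⇒≤ y<) (ℕ.m≤n+m (2 ^ w) x)) ⟩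
        (2 ^ suc d ∸ 1) * 2 ^ w + (x + 2 ^ w ∸ y)       ≡⟨ ℕ.+-comm _ (x + 2 ^ w ∸ y) ⟩
        x + 2 ^ w ∸ y + (2 ^ suc d ∸ 1) * 2 ^ w         ∎
    op-truncate mul _ _ = refl
    op-truncate div {y = zero}  _ _ = refl
    op-truncate div {y = suc _} _ _ = refl
    op-truncate mod {y = zero}  _ _ = refl
    op-truncate mod {y = suc _} _ _ = refl
    op-truncate and {x} {y} _ _ = bitwise-op _∧_ x y
    op-truncate or  {x} {y} _ _ = bitwise-op _∨_ x y
    op-truncate xor {x} {y} _ _ = bitwise-op _xor_ x y
    op-truncate shl _ _ = refl
    op-truncate shr _ _ = refl
    op-truncate eq  _ _ = refl
    op-truncate lt  _ _ = refl

    -- Memory is shared without an offset, since the expanded input is left where the simulated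
    -- program expects its own. The bounds `reg<` and `mem<` are what `op-truncate` and reloading
    -- rest on.
    record Sim (s s̃ : State) : Set where
      field
        pc≡   : pc s̃ ≡ label (pc s)
        reg≡  : ∀ r → reg s̃ (sim r) ≡ reg s r
        reg<  : ∀ r → reg s r < 2 ^ w
        mem≡  : ∀ a → mem s̃ a ≡ mem s a
        mem<  : ∀ a → mem s a < 2 ^ w
        mask  : reg s̃ 8 ≡ 2 ^ w
        blank : reg s̃ 0 ≡ 0

    fetch-++ : ∀ (xs ys : Program) i → P.fetch (xs ++ ys) (length xs + i) ≡ P.fetch ys i
    fetch-++ []       ys i = refl
    fetch-++ (_ ∷ xs) ys i = fetch-++ xs ys i

    fetch-code : ∀ {i j c} → j ≡ length pre + i → P.fetch (translate P) i ≡ c → P.fetch code j ≡ c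
    fetch-code {i} refl f = trans (fetch-++ pre (translate P) i) f

    fetch-code-suc : ∀ {i j c} → j ≡ length pre + i → P.fetch (translate P) (suc i) ≡ c →
      P.fetch code (suc j) ≡ c
    fetch-code-suc {i} e = fetch-code {suc i} (trans (cong suc e) (sym (ℕ.+-suc (length pre) i)))

    fetch-translate : ∀ R {i c} → P.fetch R i ≡ just c →
      i < length R × P.fetch (translate R) (dbl i) ≡ just (first c) ×
      P.fetch (translate R) (suc (dbl i)) ≡ just (second c)
    fetch-translate []      {zero}  ()
    fetch-translate []      {suc i} ()
    fetch-translate (c ∷ R) {zero}  refl = s≤s z≤n , refl , refl
    fetch-translate (c ∷ R) {suc i} p with fetch-translate R {i} p
    ... | a , b , e = s≤s a , b , e

    fetch-nothing : ∀ R {i} → P.fetch R i ≡ nothing → length R ≤ i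
    fetch-nothing []      {i}     p = z≤n
    fetch-nothing (c ∷ R) {suc i} p = s≤s (fetch-nothing R p)

    fetch-verdict : ∀ R → P.fetch (translate R) (dbl (length R)) ≡ just verdict ×
      P.fetch (translate R) (suc (dbl (length R))) ≡ nothing
    fetch-verdict []      = refl , refl
    fetch-verdict (c ∷ R) = fetch-verdict R

    -- One simulated instruction against two translated ones. A random `W`-bit `x` is matched with
    -- the `w`-bit draw `p.word x`, into which the second instruction turns it.
    data Outcome (s s̃ : State) : Set where
      halts : p.step P s ≡ halted →
        Q.Runs code (λ out → out ≡ bool (0 <ᵇ reg s 0)) (λ _ → 0ℚ) 2 s̃ → Outcome s s̃
      moves : ∀ {s₁ s̃₁ s̃₂} → p.step P s ≡ det s₁ →
        q.step code s̃ ≡ det s̃₁ → q.step code s̃₁ ≡ det s̃₂ → Sim s₁ s̃₂ → Outcome s s̃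
      draws : ∀ {g g̃} → p.step P s ≡ random g → q.step code s̃ ≡ random g̃ →
        (∀ x → ∃ λ s̃₂ → q.step code (g̃ x) ≡ det s̃₂ × Sim (g (p.word x)) s̃₂) → Outcome s s̃

    label-self : label (length P) ≡ length pre + dbl (length P)
    label-self = cong (λ i → length pre + dbl i) (ℕ.⊓-idem (length P))

    label-< : ∀ {i} → i < length P → label i ≡ length pre + dbl i
    label-< i< = cong (λ i → length pre + dbl i) (ℕ.m≤n⇒m⊓n≡m (ℕ.<⇒≤ i<))

    label-suc : ∀ {i} → i < length P → label (suc i) ≡ suc (suc (label i))
    label-suc {i} i< = trans (cong (λ i → length pre + dbl i) (ℕ.m≤n⇒m⊓n≡m i<))
      (trans (ℕ.+-suc (length pre) (suc (dbl i)))
        (trans (cong suc (ℕ.+-suc (length pre) (dbl i))) (cong (2 +_) (sym (label-< i<)))))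

    bool<2^W : ∀ b → bool b < 2 ^ W
    bool<2^W b =
      ℕ.<-≤-trans (s≤s (bool≤1 b)) (ℕ.≤-trans (ℕ.m≤m*n 2 (2 ^ (w + d)) {{ℕ.m^n≢0 2 (w + d)}})
        (ℕ.≤-reflexive (cong (2 ^_) (sym (ℕ.+-suc w d)))))
      where
      bool≤1 : ∀ b → bool b ≤ 1
      bool≤1 true  = ℕ.≤-refl
      bool≤1 false = z≤n

    halted-runs : ∀ {s out} → q.step code s ≡ halted → reg s 0 ≡ out →
      Q.Runs code (_≡ out) (λ _ → 0ℚ) 0 s
    halted-runs {s} h p = record
      { correct = correct
      ; time    = λ t → ℚ.≤-reflexive (trans (Q.time-halted code t {s} h) (sym (ℚ.+-identityˡ 0ℚ)))
      ; monotone = λ _ → ℚ.≤-refl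
      }
      where
      correct : Q.Correct code (_≡ _) s
      correct s′ ε                h′ = p
      correct s′ (q.detStep e ◅ _) h′ = contradiction (trans (sym h) e) λ ()
      correct s′ (q.randStep _ e ◅ _) h′ = contradiction (trans (sym h) e) λ ()

    runs-weaken : ∀ {Ans B k s} → Q.Runs code Ans B k s → Q.Runs code Ans B (suc k) s
    runs-weaken {B = B} {k} r = record
      { correct = Q.correct r
      ; time    = λ t → ℚ.≤-trans (Q.time r t) (ℚ.+-monoˡ-≤ (B t) (fromℕ-mono-≤ (ℕ.n≤1+n k)))
      ; monotone = Q.monotone r
      }

    module _ {s s̃ : State} (σ : Sim s s̃) where
      open Sim σ

      verdict-runs : ∀ {s̃′} → pc s̃′ ≡ label (length P) → reg s̃′ ≡ reg s̃ →
        Q.Runs code (λ out → out ≡ bool (0 <ᵇ reg s 0)) (λ _ → 0ℚ) 1 s̃′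
      verdict-runs {s̃′} pc≡′ refl = Q.runs-det {s = s̃′}
        (Q.step-fetch code {s̃′}
          (fetch-code {dbl (length P)} (trans pc≡′ label-self) (proj₁ (fetch-verdict P))))
        (halted-runs {s = ⟨ suc (pc s̃′) , _ , _ ⟩}
          (Q.step-end code {⟨ suc (pc s̃′) , _ , _ ⟩}
            (fetch-code-suc {dbl (length P)} (trans pc≡′ label-self) (proj₂ (fetch-verdict P))))
          (trans (m<n⇒m%n≡m {{q.2^w≢0}} (bool<2^W _))
            (cong₂ (λ x y → bool (x <ᵇ y)) blank (reg≡ 0))))

      module _ {c : Instr} (f : P.fetch P (pc s) ≡ just c) where
        pc< : pc s < length P
        pc< = proj₁ (fetch-translate P {pc s} f)

        fetch₁ : P.fetch code (pc s̃) ≡ just (first c)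
        fetch₁ =
          fetch-code {dbl (pc s)} (trans pc≡ (label-< pc<))
            (proj₁ (proj₂ (fetch-translate P {pc s} f)))

        fetch₂ : P.fetch code (suc (pc s̃)) ≡ just (second c)
        fetch₂ =
          fetch-code-suc {dbl (pc s)} (trans pc≡ (label-< pc<))
            (proj₂ (proj₂ (fetch-translate P {pc s} f)))

        step₁ : q.step code s̃ ≡ q.exec (first c) s̃
        step₁ = Q.step-fetch code {s̃} fetch₁

        step₂ : ∀ {R M} →
          let s̃₁ = ⟨ suc (pc s̃) , R , M ⟩ in q.step code s̃₁ ≡ q.exec (second c) s̃₁
        step₂ {R} {M} = Q.step-fetch code {⟨ suc (pc s̃) , R , M ⟩} fetch₂

        pc≡₂ : suc (suc (pc s̃)) ≡ label (suc (pc s))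
        pc≡₂ = trans (cong (2 +_) pc≡) (sym (label-suc pc<))

        truncated-sim : ∀ r {x y M} → p.word x ≡ y → (∀ a → M a ≡ mem s a) →
          let R = reg s̃ [ sim r ≔ x ] in
          Sim ⟨ suc (pc s) , reg s [ r ≔ y ] , mem s ⟩
              ⟨ suc (suc (pc s̃)) , R [ sim r ≔ q.word (q.⟦ mod ⟧ (R (sim r)) (R 8)) ] , M ⟩
        truncated-sim r {x} {y} x≡y M≡ = record
          { pc≡   = pc≡₂
          ; reg≡  = λ b → trans (update-update (reg s̃) (sim r) x _ (sim b))
                      (update-cong {reg s̃} sim r (λ _ → refl) reg≡ reduced b)
          ; reg<  = update-all (_< 2 ^ w) r reg< (subst (_< 2 ^ w) x≡y (word< x))
          ; mem≡  = M≡
          ; mem<  = mem<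
          -- The writes to `sim r` miss registers 0 and 8 by computation, as `16 + r ≡ᵇ 8` reduces
          -- to `false`.
          ; mask  = mask
          ; blank = blank
          }
          where
          R = reg s̃ [ sim r ≔ x ]
          reduced : q.word (q.⟦ mod ⟧ (R (sim r)) (R 8)) ≡ y
          reduced =
            trans (cong₂ (λ a b → q.word (q.⟦ mod ⟧ a b)) (update-here (reg s̃) (sim r) x) mask)
            (trans (truncated x) x≡y)

      outcome : Outcome s s̃
      outcome with P.fetch P (pc s) in f
      -- Past the end only the verdict is left; its cost 1 is weakened to 2 to agree with `halt`,
      -- which also pays for a jump.
      ... | nothing = halts (P.step-end P {s} f)
        (runs-weaken (verdict-runs {s̃} (trans pc≡ (cong (λ i → length pre + dbl i)
          (trans (ℕ.m≥n⇒m⊓n≡n (fetch-nothing P f)) (sym (ℕ.⊓-idem (length P)))))) refl))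
      ... | just halt = halts (P.step-fetch P {s} f)
        (Q.runs-det {s = s̃} (step₁ f) (verdict-runs refl refl))
      ... | just (const r x) = moves (P.step-fetch P {s} f) (step₁ f) (step₂ f)
        (truncated-sim f r (word-word x) mem≡)
      ... | just (arith o r a b) = moves (P.step-fetch P {s} f) (step₁ f) (step₂ f)
        (truncated-sim f r
          (trans (word-word _) (trans (cong₂ (λ x y → p.word (q.⟦ o ⟧ x y)) (reg≡ a) (reg≡ b))
          (op-truncate o (reg< a) (reg< b)))) mem≡)
      ... | just (load r a) = moves (P.step-fetch P {s} f) (step₁ f) (step₂ f)
        (truncated-sim f r (trans (cong p.word loaded) (word-id (mem< (reg s a)))) mem≡)
        where
        loaded : mem s̃ (reg s̃ (sim a)) ≡ mem s (reg s a)
        loaded = trans (mem≡ _) (cong (mem s) (reg≡ a))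
      ... | just (store a b) = moves (P.step-fetch P {s} f) (step₁ f) (step₂ f) record
        { pc≡   = pc≡₂ f
        ; reg≡  = reg≡
        ; reg<  = reg<
        ; mem≡  = λ x → trans (cong (λ i → (mem s̃ [ i ≔ reg s̃ (sim b) ]) x) (reg≡ a))
                    (update-cong (λ i → i) (reg s a) (λ _ → refl) mem≡ (reg≡ b) x)
        ; mem<  = update-all (_< 2 ^ w) (reg s a) mem< (reg< b)
        ; mask  = mask
        ; blank = blank
        }
      ... | just (rand r) = draws (P.step-fetch P {s} f) (step₁ f) λ x → _ , step₂ f ,
        truncated-sim f r {x} refl mem≡
      ... | just (jmp l) = moves (P.step-fetch P {s} f) (step₁ f) (step₂ f) record
        { pc≡ = refl ; reg≡ = reg≡ ; reg< = reg< ; mem≡ = mem≡ ; mem< = mem<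
        ; mask = mask ; blank = blank }
      ... | just (jz r l) = moves (P.step-fetch P {s} f) (step₁ f) (step₂ f) record
        { pc≡ = branch ; reg≡ = reg≡ ; reg< = reg< ; mem≡ = mem≡ ; mem< = mem<
        ; mask = mask ; blank = blank }
        where
        branch : (if reg s̃ (sim r) ≡ᵇ 0 then label l else suc (suc (pc s̃))) ≡
                 label (if reg s r ≡ᵇ 0 then l else suc (pc s))
        branch rewrite reg≡ r with reg s r ≡ᵇ 0
        ... | true  = refl
        ... | false = pc≡₂ f

    Verdict : (ℕ → Set) → ℕ → Set
    Verdict Ans out = ∃ λ N → Ans N × out ≡ bool (0 <ᵇ N)

    -- Projects each halting run of the translated code to one of the original, two steps at a time.
    -- A run cannot halt between the two halves of a pair, because the second half always makes a
    -- step.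
    sim-correct : ∀ {Ans s s̃} → Sim s s̃ → P.Correct P Ans s → Q.Correct code (Verdict Ans) s̃
    sim-correct {Ans} {s} σ c s′ r h with outcome σ
    ... | halts e run = reg s 0 , c s ε e , Q.correct run s′ r h
    sim-correct σ c s′ ε h | moves e e₁ e₂ σ′ = contradiction (trans (sym e₁) h) λ ()
    sim-correct σ c s′ (q.randStep _ k ◅ r) h | moves e e₁ e₂ σ′ =
      contradiction (trans (sym e₁) k) λ ()
    sim-correct σ c s′ (q.detStep k ◅ r) h | moves e e₁ e₂ σ′ with trans (sym e₁) k
    sim-correct σ c s′ (q.detStep k ◅ ε) h | moves e e₁ e₂ σ′ | refl =
      contradiction (trans (sym e₂) h) λ ()
    sim-correct σ c s′ (q.detStep k ◅ q.randStep _ k′ ◅ r) h | moves e e₁ e₂ σ′ | refl =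
      contradiction (trans (sym e₂) k′) λ ()
    sim-correct σ c s′ (q.detStep k ◅ q.detStep k′ ◅ r) h | moves e e₁ e₂ σ′ | refl
      with trans (sym e₂) k′
    ... | refl = sim-correct σ′ (λ s″ r′ → c s″ (p.detStep e ◅ r′)) s′ r h
    sim-correct σ c s′ ε h | draws e e₁ e₂ = contradiction (trans (sym e₁) h) λ ()
    sim-correct σ c s′ (q.detStep k ◅ r) h | draws e e₁ e₂ = contradiction (trans (sym e₁) k) λ ()
    sim-correct σ c s′ (q.randStep x k ◅ r) h | draws e e₁ e₂ with trans (sym e₁) k | e₂ (toℕ x)
    sim-correct σ c s′ (q.randStep x k ◅ ε) h | draws e e₁ e₂ | refl | s̃₂ , e₃ , σ′ =
      contradiction (trans (sym e₃) h) λ ()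
    sim-correct σ c s′ (q.randStep x k ◅ q.randStep _ k′ ◅ r) h
      | draws e e₁ e₂ | refl | s̃₂ , e₃ , σ′ = contradiction (trans (sym e₃) k′) λ ()
    sim-correct {Ans} σ c s′ (q.randStep x k ◅ q.detStep k′ ◅ r) h
      | draws {g} e e₁ e₂ | refl | s̃₂ , e₃ , σ′ with trans (sym e₃) k′
    ... | refl =
        sim-correct σ′ (subst (λ y → P.Correct P Ans (g y)) (Fin.toℕ-fromℕ< (word< (toℕ x)))
                   (λ s″ r′ → c s″ (p.randStep (fromℕ< (word< (toℕ x))) e ◅ r′))) s′ r h

    -- The low bits of a uniform long word are uniform: each `w`-bit word arises from `2 ^ suc d`
    -- long ones.
    mean-word : ∀ F → mean (2 ^ W) {{q.2^w≢0}} (F ∘ p.word) ≡ mean (2 ^ w) {{p.2^w≢0}} F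
    mean-word F =
      trans (mean-cong {G = F ∘ p.word} 2^W {{q.2^w≢0}} {{nz}})
        (mean-periodic (2 ^ suc d) (2 ^ w) {{p.2^w≢0}} {{nz}} F)
      where
      nz : NonZero (2 ^ suc d * 2 ^ w)
      nz = subst NonZero 2^W q.2^w≢0
      mean-cong : ∀ {m n} {G : ℕ → ℚ} (e : m ≡ n) .{{_ : NonZero m}} .{{_ : NonZero n}} →
        mean m G ≡ mean n G
      mean-cong refl = refl

    -- The additive 2 pays for reading off the verdict.
    slowdown : ℚ → ℚ
    slowdown x = fromℕ 2 ℚ.+ fromℕ 2 ℚ.* x

    slowdown-step : ∀ x → 1ℚ ℚ.+ (1ℚ ℚ.+ slowdown x) ≡ slowdown (1ℚ ℚ.+ x)
    slowdown-step x = begin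
      1ℚ ℚ.+ (1ℚ ℚ.+ slowdown x)                     ≡⟨ ℚ.+-assoc 1ℚ 1ℚ (slowdown x) ⟨
      fromℕ 2 ℚ.+ (fromℕ 2 ℚ.+ fromℕ 2 ℚ.* x)
        ≡⟨ cong (fromℕ 2 ℚ.+_) (ℚ.*-distribˡ-+ (fromℕ 2) 1ℚ x) ⟨
      slowdown (1ℚ ℚ.+ x)                            ∎
      where open ≡-Reasoning

    0≤slowdown : ∀ {x} → 0ℚ ℚ.≤ x → 0ℚ ℚ.≤ slowdown x
    0≤slowdown 0≤x = 0≤+ (0≤fromℕ 2) (0≤* (0≤fromℕ 2) 0≤x)

    sim-time : ∀ t {s s̃} → Sim s s̃ →
      q.truncatedTime code (dbl t) s̃ ℚ.≤ slowdown (p.truncatedTime P t s)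
    sim-time zero σ = 0≤slowdown ℚ.≤-refl
    sim-time (suc t) {s} {s̃} σ with outcome σ
    ... | halts e run = ℚ.≤-trans (Q.time run (dbl (suc t))) (ℚ.+-monoʳ-≤ (fromℕ 2)
            (0≤* (0≤fromℕ 2) (P.time-nonNeg P (suc t) s)))
    ... | moves {s₁} {s̃₁} {s̃₂} e e₁ e₂ σ′ = begin
      q.truncatedTime code (dbl (suc t)) s̃
        ≡⟨ Q.time-det code (suc (dbl t)) {s̃} e₁ ⟩
      1ℚ ℚ.+ q.truncatedTime code (suc (dbl t)) s̃₁
        ≡⟨ cong (1ℚ ℚ.+_) (Q.time-det code (dbl t) {s̃₁} e₂) ⟩
      1ℚ ℚ.+ (1ℚ ℚ.+ q.truncatedTime code (dbl t) s̃₂)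
        ≤⟨ ℚ.+-monoʳ-≤ 1ℚ (ℚ.+-monoʳ-≤ 1ℚ (sim-time t σ′)) ⟩
      1ℚ ℚ.+ (1ℚ ℚ.+ slowdown (p.truncatedTime P t s₁))
        ≡⟨ slowdown-step (p.truncatedTime P t s₁) ⟩
      slowdown (1ℚ ℚ.+ p.truncatedTime P t s₁)
        ≡⟨ cong slowdown (P.time-det P t {s} e) ⟨
      slowdown (p.truncatedTime P (suc t) s)                        ∎
      where open ℚ.≤-Reasoning
    ... | draws {g} {g̃} e e₁ e₂ = begin
      q.truncatedTime code (dbl (suc t)) s̃
        ≡⟨ Q.time-random code (suc (dbl t)) {s̃} e₁ ⟩
      1ℚ ℚ.+ meanW (λ x → q.truncatedTime code (suc (dbl t)) (g̃ x))
        ≤⟨ ℚ.+-monoʳ-≤ 1ℚ (mean-mono (2 ^ W) {{q.2^w≢0}} λ x _ → drawn x) ⟩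
      1ℚ ℚ.+ meanW (λ x → 1ℚ ℚ.+ slowdown (F (p.word x)))
        ≡⟨ cong (1ℚ ℚ.+_) (mean-word (λ x → 1ℚ ℚ.+ slowdown (F x))) ⟩
      1ℚ ℚ.+ meanw (λ x → 1ℚ ℚ.+ slowdown (F x))
        -- Regrouped as an affine function of `F x`, so that linearity of expectation moves the
        -- average inside `slowdown`.
        ≡⟨ cong (1ℚ ℚ.+_) (mean-cong λ x → sym (ℚ.+-assoc 1ℚ (fromℕ 2) (fromℕ 2 ℚ.* F x))) ⟩
      1ℚ ℚ.+ meanw (λ x → 1ℚ ℚ.+ fromℕ 2 ℚ.+ fromℕ 2 ℚ.* F x)
        ≡⟨ cong (1ℚ ℚ.+_) (mean-affine (2 ^ w) {{p.2^w≢0}} (1ℚ ℚ.+ fromℕ 2) (fromℕ 2) F) ⟩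
      1ℚ ℚ.+ (1ℚ ℚ.+ fromℕ 2 ℚ.+ fromℕ 2 ℚ.* meanw F)
        ≡⟨ cong (1ℚ ℚ.+_) (ℚ.+-assoc 1ℚ (fromℕ 2) (fromℕ 2 ℚ.* meanw F)) ⟩
      1ℚ ℚ.+ (1ℚ ℚ.+ slowdown (meanw F))                            ≡⟨ slowdown-step (meanw F) ⟩
      slowdown (1ℚ ℚ.+ meanw F)
        ≡⟨ cong slowdown (P.time-random P t {s} e) ⟨
      slowdown (p.truncatedTime P (suc t) s)                        ∎
      where
      open ℚ.≤-Reasoning
      meanW = mean (2 ^ W) {{q.2^w≢0}}
      meanw = mean (2 ^ w) {{p.2^w≢0}}
      F : ℕ → ℚ
      F x = p.truncatedTime P t (g x)
      mean-cong : ∀ {F G : ℕ → ℚ} → (∀ x → F x ≡ G x) → meanw F ≡ meanw G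
      mean-cong F≡G = cong (ℚ._* unit (2 ^ w) {{p.2^w≢0}}) (Σ<-cong (2 ^ w) λ x _ → F≡G x)
      drawn : ∀ x → q.truncatedTime code (suc (dbl t)) (g̃ x) ℚ.≤ 1ℚ ℚ.+ slowdown (F (p.word x))
      drawn x with e₂ x
      ... | s̃₂ , e₃ , σ′ = ℚ.≤-trans (ℚ.≤-reflexive (Q.time-det code (dbl t) {g̃ x} e₃))
        (ℚ.+-monoʳ-≤ 1ℚ (sim-time t σ′))

    simulate : ∀ {Ans s s̃} → Sim s s̃ → P.Correct P Ans s →
      Q.Runs code (Verdict Ans) (λ t → fromℕ 2 ℚ.* p.truncatedTime P t s) 2 s̃
    simulate {s = s} {s̃} σ c = record
      { correct  = sim-correct σ c
      -- Truncating at `t` instead of `dbl t` only lowers the left side.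
      ; time     = λ t → ℚ.≤-trans (Q.time-mono code s̃ (n≤dbl t)) (sim-time t σ)
      ; monotone = λ t → ℚ.*-monoˡ-≤-nonNeg (fromℕ 2) (P.time-mono P s (ℕ.n≤1+n t))
      }

  -- Consecutive writes, bit lengths and the prefix.

  update-there : ∀ (f : ℕ → ℕ) {a b} x → b ≢ a → (f [ a ≔ x ]) b ≡ f b
  update-there f {a} {b} x b≢a with a ≡ᵇ b in e
  ... | false = refl
  ... | true  = contradiction (sym (ℕ.≡ᵇ⇒≡ a b (subst T (sym e) _))) b≢a

  -- Addresses here are variables and `≡ᵇ` on them is stuck, so the cell is compared with the four
  -- targets from the last write backwards; a cell that differs from all of them lies below or above
  -- the block.
  update₄ : ∀ (f : ℕ → ℕ) b {x₀ x₁ x₂ x₃} (Q : ℕ → ℕ → Set) →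
    Q b x₀ → Q (1 + b) x₁ → Q (2 + b) x₂ → Q (3 + b) x₃ →
    (∀ a → a < b ⊎ 4 + b ≤ a → Q a (f a)) →
    ∀ a → Q a (((((f [ b ≔ x₀ ]) [ 1 + b ≔ x₁ ]) [ 2 + b ≔ x₂ ]) [ 3 + b ≔ x₃ ]) a)
  update₄ f b {x₀} {x₁} {x₂} {x₃} Q q₀ q₁ q₂ q₃ q a = top
    where
    f₀ = f [ b ≔ x₀ ]
    f₁ = f₀ [ 1 + b ≔ x₁ ]
    f₂ = f₁ [ 2 + b ≔ x₂ ]

    else : a ≢ b → a ≢ 1 + b → a ≢ 2 + b → a ≢ 3 + b → Q a (f a)
    else a≢0 a≢1 a≢2 a≢3 with ℕ.<-≤-connex a b
    ... | inj₁ a<b = q a (inj₁ a<b)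
    ... | inj₂ b≤a =
        q a (inj₂
          (ℕ.≤∧≢⇒< (ℕ.≤∧≢⇒< (ℕ.≤∧≢⇒< (ℕ.≤∧≢⇒< b≤a (a≢0 ∘ sym)) (a≢1 ∘ sym)) (a≢2 ∘ sym))
            (a≢3 ∘ sym)))

    top : Q a ((f₂ [ 3 + b ≔ x₃ ]) a)
    top with a ℕ.≟ 3 + b
    ... | yes refl = subst (Q (3 + b)) (sym (update-here f₂ (3 + b) x₃)) q₃
    ... | no a≢3 with a ℕ.≟ 2 + b
    ... | yes refl =
        subst (Q (2 + b)) (sym (trans (update-there f₂ x₃ a≢3) (update-here f₁ (2 + b) x₂))) q₂
    ... | no a≢2 with a ℕ.≟ 1 + b
    ... | yes refl =
        subst (Q (1 + b))
          (sym (trans (update-there f₂ x₃ a≢3)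
            (trans (update-there f₁ x₂ a≢2) (update-here f₀ (1 + b) x₁)))) q₁
    ... | no a≢1 with a ℕ.≟ b
    ... | yes refl =
        subst (Q b)
          (sym (trans (update-there f₂ x₃ a≢3)
            (trans (update-there f₁ x₂ a≢2)
              (trans (update-there f₀ x₁ a≢1) (update-here f b x₀))))) q₀
    ... | no a≢0 =
        subst (Q a)
          (sym (trans (update-there f₂ x₃ a≢3)
            (trans (update-there f₁ x₂ a≢2)
              (trans (update-there f₀ x₁ a≢1) (update-there f x₀ a≢0))))) (else a≢0 a≢1 a≢2 a≢3)

  n<2^n : ∀ n → n < 2 ^ n
  n<2^n zero    = s≤s z≤n
  n<2^n (suc n) = ℕ.+-mono-≤ (ℕ.m^n>0 2 n) (ℕ.≤-trans (n<2^n n) (ℕ.m≤m+n (2 ^ n) 0))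

  -- The second index is the bit length of the first, presented as the trace of the loop that halves
  -- a number until it is 0, so that the loop can be verified by recursion on it.
  data Halvings : ℕ → ℕ → Set where
    over : Halvings 0 0
    half : ∀ {x j} → Halvings (suc x / 2) j → Halvings (suc x) (suc j)

  /2≡⌊/2⌋ : ∀ n → n / 2 ≡ ⌊ n /2⌋
  /2≡⌊/2⌋ zero          = refl
  /2≡⌊/2⌋ (suc zero)    = refl
  /2≡⌊/2⌋ (suc (suc n)) =
    trans (m/n≡1+[m∸n]/n {suc (suc n)} {2} (s≤s (s≤s z≤n))) (cong suc (/2≡⌊/2⌋ n))

  -- Ties the number of rounds of the counting loop to the logarithm in the definition of the word
  -- length.
  halvings : ∀ n → .{{_ : NonZero n}} → Halvings n (suc ⌊log₂ n ⌋)
  halvings n = <-rec (λ n → .{{_ : NonZero n}} → Halvings n (suc ⌊log₂ n ⌋)) rec n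
    where
    rec : ∀ n → (∀ {k} → k < n → .{{_ : NonZero k}} → Halvings k (suc ⌊log₂ k ⌋)) →
      .{{_ : NonZero n}} → Halvings n (suc ⌊log₂ n ⌋)
    rec (suc zero)    ih = half over
    rec n@(suc (suc k)) ih = half (subst₂ Halvings (sym (/2≡⌊/2⌋ n)) log
      (ih {⌊ n /2⌋} (ℕ.⌊n/2⌋<n (suc k))))
      where
      log : suc ⌊log₂ ⌊ n /2⌋ ⌋ ≡ ⌊log₂ n ⌋
      log = trans (cong suc (⌊log₂⌊n/2⌋⌋≡⌊log₂n⌋∸1 n))
        (ℕ.m+[n∸m]≡n {1} (⌊log₂⌋-mono-≤ {2} {n} (s≤s (s≤s z≤n))))

  -- Registers: 2 holds the multiplicity, 3 and 4 the numbers n of vertices and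
  -- s of edges of the subdivision still to be written, 8 the mask 2 ^ w.
  -- The edges are expanded in place, from the last one down, so that a write
  -- never hits an edge that is still to be read.
  prefix : ℕ → ℕ → Program
  prefix factor multiplicity =
      const 1 1
    ∷ const 2 multiplicity
    ∷ load 3 0
    ∷ load 4 1
    ∷ arith mul 4 4 2
    ∷ arith add 5 3 4
    ∷ arith add 6 4 4
    ∷ arith add 7 5 0
    ∷ const 9 2
    ∷ jz 7 13
    ∷ arith div 7 7 9
    ∷ arith add 8 8 1
    ∷ jmp 9
    ∷ const 10 factor
    ∷ arith mul 8 10 8
    ∷ arith shl 8 1 8
    ∷ arith mod 5 5 8
    ∷ arith mod 6 6 8
    ∷ store 0 5
    ∷ store 1 6
    ∷ jz 4 43
    ∷ arith sub 4 4 1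
    ∷ arith div 5 4 2
    ∷ arith add 5 5 5
    ∷ arith add 5 5 9
    ∷ load 6 5
    ∷ arith add 5 5 1
    ∷ load 7 5
    ∷ arith mod 6 6 8
    ∷ arith mod 7 7 8
    ∷ arith add 10 3 4
    ∷ arith mod 10 10 8
    ∷ arith add 11 4 4
    ∷ arith add 11 11 11
    ∷ arith add 11 11 9
    ∷ store 11 6
    ∷ arith add 11 11 1
    ∷ store 11 10
    ∷ arith add 11 11 1
    ∷ store 11 7
    ∷ arith add 11 11 1
    ∷ store 11 10
    ∷ jmp 20
    ∷ []

  -- Symbolic execution of the prefix.

  module RunsSteps (W : ℕ) (Q : Program) (Ans : ℕ → Set) (B : ℕ → ℚ) where
    open RAM W
    open Runs W

    _Reaches_ : ℕ → State → Set
    k Reaches s = Runs Q Ans B k s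

    -- In each of these rules the equations replace a computed value by a closed form `z`, so that
    -- later lookups of known registers hold by `refl`.
    const-runs : ∀ {k i R M r x z} → fetch Q i ≡ just (const r x) → word x ≡ z →
      k Reaches ⟨ suc i , R [ r ≔ z ] , M ⟩ → suc k Reaches ⟨ i , R , M ⟩
    const-runs {i = i} {R} {M} f refl =
      runs-det {s = ⟨ i , R , M ⟩} (step-fetch Q {⟨ i , R , M ⟩} f)

    arith-runs : ∀ {k i R M o r a b x y z} → fetch Q i ≡ just (arith o r a b) → R a ≡ x → R b ≡ y →
      word (⟦ o ⟧ x y) ≡ z → k Reaches ⟨ suc i , R [ r ≔ z ] , M ⟩ → suc k Reaches ⟨ i , R , M ⟩
    arith-runs {i = i} {R} {M} f refl refl refl =
      runs-det {s = ⟨ i , R , M ⟩} (step-fetch Q {⟨ i , R , M ⟩} f)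

    load-runs : ∀ {k i R M r a x z} → fetch Q i ≡ just (load r a) → R a ≡ x → M x ≡ z →
      k Reaches ⟨ suc i , R [ r ≔ z ] , M ⟩ → suc k Reaches ⟨ i , R , M ⟩
    load-runs {i = i} {R} {M} f refl refl =
      runs-det {s = ⟨ i , R , M ⟩} (step-fetch Q {⟨ i , R , M ⟩} f)

    store-runs : ∀ {k i R M a b x y} → fetch Q i ≡ just (store a b) → R a ≡ x → R b ≡ y →
      k Reaches ⟨ suc i , R , M [ x ≔ y ] ⟩ → suc k Reaches ⟨ i , R , M ⟩
    store-runs {i = i} {R} {M} f refl refl =
      runs-det {s = ⟨ i , R , M ⟩} (step-fetch Q {⟨ i , R , M ⟩} f)

    jmp-runs : ∀ {k i R M l} → fetch Q i ≡ just (jmp l) →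
      k Reaches ⟨ l , R , M ⟩ → suc k Reaches ⟨ i , R , M ⟩
    jmp-runs {i = i} {R} {M} f = runs-det {s = ⟨ i , R , M ⟩} (step-fetch Q {⟨ i , R , M ⟩} f)

    jz-runs : ∀ {k i R M r l} → fetch Q i ≡ just (jz r l) → R r ≡ 0 →
      k Reaches ⟨ l , R , M ⟩ → suc k Reaches ⟨ i , R , M ⟩
    jz-runs {i = i} {R} {M} {r} {l} f z = runs-det {s = ⟨ i , R , M ⟩}
      (trans (step-fetch Q {⟨ i , R , M ⟩} f)
        (cong (λ x → det ⟨ (if x ≡ᵇ 0 then l else suc i) , R , M ⟩) z))

    jz-falls : ∀ {k i R M r l x} → fetch Q i ≡ just (jz r l) → R r ≡ suc x →
      k Reaches ⟨ suc i , R , M ⟩ → suc k Reaches ⟨ i , R , M ⟩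
    jz-falls {i = i} {R} {M} {r} {l} f z = runs-det {s = ⟨ i , R , M ⟩}
      (trans (step-fetch Q {⟨ i , R , M ⟩} f)
        (cong (λ x → det ⟨ (if x ≡ᵇ 0 then l else suc i) , R , M ⟩) z))

  module Preprocessing (factor t w d : ℕ) (P : Program) (n m ℓ : ℕ) (src dst : ℕ → ℕ)
    (w≡ : w ≡ factor * ℓ) (Ans : ℕ → Set) (B : ℕ → ℚ) where

    private
      module p = RAM w
      module q = RAM (w + suc d)
      module S = Simulation w d (prefix factor (suc t)) P
      2^W = 2 ^ (w + suc d)

      M : ℕ
      M = m * suc t

    open RunsSteps (w + suc d) S.code Ans B

    -- All that the prefix has to know about the two inputs, stated for plain numbers so that its
    -- verification is free of graphs.
    record Layout : Set where
      field
        src-0    : src 0 ≡ n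
        src-1    : src 1 ≡ m
        dst-0    : dst 0 ≡ n + M
        dst-1    : dst 1 ≡ M * 2
        dst-end₁ : ∀ s → s < M → dst (2 + s * 4) ≡ src (2 + s / suc t * 2)
        dst-mid₁ : ∀ s → s < M → dst (3 + s * 4) ≡ n + s
        dst-end₂ : ∀ s → s < M → dst (4 + s * 4) ≡ src (3 + s / suc t * 2)
        dst-mid₂ : ∀ s → s < M → dst (5 + s * 4) ≡ n + s
        src-high : ∀ a → 2 + M * 4 ≤ a → src a ≡ 0
        dst-high : ∀ a → 2 + M * 4 ≤ a → dst a ≡ 0

    -- `big<` covers the addresses and vertex numbers that the prefix forms; its 6 leaves room for
    -- the header and for small constants.
    record Fits : Set where
      field
        src<  : ∀ a → src a < 2^W
        big<  : n + M * 4 + 6 < 2^W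
        mult< : suc t < 2^W
        factor< : factor < 2^W
        bits< : ℓ < 2^W

    module _ (layout : Layout) (fits : Fits) where
      open Layout layout
      open Fits fits

      small : ∀ {x} → x < 2^W → q.word x ≡ x
      small = m<n⇒m%n≡m {{q.2^w≢0}}

      -- Invariant of the loop at instruction 9, which counts the bits of n + M.
      record Counting (R : ℕ → ℕ) (x k : ℕ) : Set where
        field
          r0 : R 0 ≡ 0
          r1 : R 1 ≡ 1
          r2 : R 2 ≡ suc t
          r3 : R 3 ≡ n
          r4 : R 4 ≡ M
          r5 : R 5 ≡ n + M
          r6 : R 6 ≡ M + M
          r7 : R 7 ≡ x
          r8 : R 8 ≡ k
          r9 : R 9 ≡ 2
          rs : ∀ r → R (sim r) ≡ 0

      count-loop : ∀ {x j K k R mm} → Halvings x j → Counting R x k → x < 2^W → k + j < 2^W →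
        (∀ {R} → Counting R 0 (k + j) → K Reaches ⟨ 13 , R , mm ⟩) →
        (j * 4 + suc K) Reaches ⟨ 9 , R , mm ⟩
      count-loop {k = k} over c x< k< next = jz-runs refl r7
        (next (record { Counting c ; r8 = trans r8 (sym (ℕ.+-identityʳ k)) }))
        where open Counting c
      count-loop {suc x} {suc j} {K} {k} {R} h@(half h′) c x< k< next =
        jz-falls refl r7 $
        arith-runs refl r7 r9 (small (ℕ.≤-<-trans (m/n≤m (suc x) 2) x<)) $
        arith-runs refl r8 r1 (small (ℕ.≤-<-trans (ℕ.+-monoʳ-≤ k (s≤s z≤n)) k<)) $
        jmp-runs refl $
        count-loop h′ record
          { r0 = r0 ; r1 = r1 ; r2 = r2 ; r3 = r3 ; r4 = r4
          ; r5 = r5 ; r6 = r6 ; r7 = refl ; r8 = refl ; r9 = r9 ; rs = rs }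
          (ℕ.≤-<-trans (m/n≤m (suc x) 2) x<) (subst (_< 2^W) k+ k<)
            (λ c′ → next (subst (Counting _ 0) (sym k+) c′))
        where
        open Counting c
        k+ : k + suc j ≡ k + 1 + j
        k+ = sym (ℕ.+-assoc k 1 j)

      -- Invariant of the loop at instruction 20.
      record Expanding (R : ℕ → ℕ) (s : ℕ) : Set where
        field
          r0 : R 0 ≡ 0
          r1 : R 1 ≡ 1
          r2 : R 2 ≡ suc t
          r3 : R 3 ≡ n
          r4 : R 4 ≡ s
          r8 : R 8 ≡ 2 ^ w
          r9 : R 9 ≡ 2
          rs : ∀ r → R (sim r) ≡ 0

      record Content (s a v : ℕ) : Set where
        field
          header : a < 2 → v ≡ p.word (dst a)
          todo   : 2 ≤ a → a < 2 + s * 4 → v ≡ src a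
          done   : 2 + s * 4 ≤ a → v ≡ p.word (dst a)

      expand-loop : ∀ {K R mm} s → s ≤ M → Expanding R s → (∀ a → Content s a (mm a)) →
        (∀ {R mm} → Expanding R 0 → (∀ a → Content 0 a (mm a)) → K Reaches ⟨ 43 , R , mm ⟩) →
        (s * 23 + suc K) Reaches ⟨ 20 , R , mm ⟩
      expand-loop zero _ e c next = jz-runs refl (Expanding.r4 e) (next e c)
      expand-loop {K} {R} {mm} (suc s) s<M e c next =
        jz-falls refl r4 $
        arith-runs refl r4 r1 sub-one $
        arith-runs refl refl r2 (small (below (ℕ.≤-trans i≤s s≤))) $
        arith-runs {z = i + i} refl refl refl (small (below i+i≤)) $
        arith-runs {z = 2 + i * 2} refl refl r9 (fit (double i) (ℕ.≤-trans (ℕ.n≤1+n _) src-index)) $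
        load-runs {z = src (2 + i * 2)} refl refl
          (Content.todo (c _) (s≤s (s≤s z≤n)) (ℕ.<-trans (ℕ.n<1+n _) src-index<)) $
        arith-runs {z = 3 + i * 2} refl refl r1 (fit (ℕ.+-comm (2 + i * 2) 1) src-index) $
        load-runs {z = src (3 + i * 2)} refl refl (Content.todo (c _) (s≤s (s≤s z≤n)) src-index<) $
        arith-runs refl refl r8 (S.truncated (src (2 + i * 2))) $
        arith-runs refl refl r8 (S.truncated (src (3 + i * 2))) $
        arith-runs {z = n + s} refl r3 refl (small n+s<) $
        arith-runs refl refl r8 (S.truncated (n + s)) $
        arith-runs {z = s + s} refl refl refl (small (below s+s≤)) $
        arith-runs {z = s + s + (s + s)} refl refl refl
          (small (below
            (ℕ.≤-trans (ℕ.m≤m+n _ 2) (ℕ.≤-reflexive (quadruple s)) ⟨≤⟩ cell 2 (s≤s (s≤s z≤n))))) $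
        arith-runs {z = 2 + s * 4} refl refl r9 (fit (quadruple s) (cell 2 (s≤s (s≤s z≤n)))) $
        store-runs refl refl refl $
        arith-runs {z = 3 + s * 4} refl refl r1
          (fit (ℕ.+-comm (2 + s * 4) 1) (cell 3 (s≤s (s≤s (s≤s z≤n))))) $
        store-runs refl refl refl $
        arith-runs {z = 4 + s * 4} refl refl r1
          (fit (ℕ.+-comm (3 + s * 4) 1) (cell 4 (s≤s (s≤s (s≤s (s≤s z≤n)))))) $
        store-runs refl refl refl $
        arith-runs {z = 5 + s * 4} refl refl r1 (fit (ℕ.+-comm (4 + s * 4) 1) (cell 5 ℕ.≤-refl)) $
        store-runs refl refl refl $
        jmp-runs refl $
        expand-loop s (ℕ.<⇒≤ s<M)
          record { r0 = r0 ; r1 = r1 ; r2 = r2 ; r3 = r3 ; r4 = refl ; r8 = r8 ; r9 = r9 ; rs = rs }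
          (update₄ mm (2 + s * 4) (Content s)
            (written 0 (cong p.word (sym (dst-end₁ s s<M))))
            (written 1 (cong p.word (sym (dst-mid₁ s s<M))))
            (written 2 (cong p.word (sym (dst-end₂ s s<M))))
            (written 3 (cong p.word (sym (dst-mid₂ s s<M))))
            unwritten)
          next
        where
        open Expanding e
        _⟨≤⟩_ = ℕ.≤-trans

        i : ℕ
        i = s / suc t

        i≤s : i ≤ s
        i≤s = m/n≤m s (suc t)

        top : ℕ
        top = 5 + s * 4

        top< : top < 2^W
        -- `5 + s * 4` is `1 + suc s * 4` by computation, hence at most `1 + M * 4`.
        top< = ℕ.≤-<-trans (ℕ.+-monoʳ-≤ 1 (ℕ.*-monoˡ-≤ 4 s<M)) (ℕ.≤-<-trans
          (ℕ.≤-trans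
            (ℕ.≤-trans (ℕ.+-monoˡ-≤ (M * 4) {1} {6} (s≤s z≤n)) (ℕ.≤-reflexive (ℕ.+-comm 6 (M * 4))))
            (ℕ.≤-trans (ℕ.m≤n+m (M * 4 + 6) n) (ℕ.≤-reflexive (sym (ℕ.+-assoc n (M * 4) 6))))) big<)

        below : ∀ {x} → x ≤ top → x < 2^W
        below x≤ = ℕ.≤-<-trans x≤ top<

        fit : ∀ {x y} → x ≡ y → y ≤ top → q.word x ≡ y
        fit refl y≤ = small (below y≤)

        cell : ∀ j → j ≤ 5 → j + s * 4 ≤ top
        cell j j≤5 = ℕ.+-monoˡ-≤ (s * 4) j≤5

        s≤ : s ≤ top
        s≤ = ℕ.≤-trans (ℕ.m≤m*n s 4) (ℕ.m≤n+m (s * 4) 5)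

        double : ∀ i → i + i + 2 ≡ 2 + i * 2
        double = solve-∀

        quadruple : ∀ s → s + s + (s + s) + 2 ≡ 2 + s * 4
        quadruple = solve-∀

        src-index : 3 + i * 2 ≤ top
        src-index =
          ℕ.+-mono-≤ {3} {5} (s≤s (s≤s (s≤s z≤n)))
            (ℕ.≤-trans (ℕ.*-monoˡ-≤ 2 i≤s) (ℕ.*-monoʳ-≤ s {2} {4} (s≤s (s≤s z≤n))))

        -- Original edge `i` ≤ `s` occupies cells `2 + i * 2` and `3 + i * 2`, while the later
        -- rounds have written only from cell `2 + suc s * 4` on. Overlap within a round is
        -- harmless, as both loads precede the four stores.
        src-index< : 3 + i * 2 < 2 + suc s * 4
        src-index< = s≤s (ℕ.≤-trans src-index ℕ.≤-refl)

        i+i≤ : i + i ≤ top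
        i+i≤ = ℕ.≤-trans (ℕ.m≤m+n (i + i) 2)
          (ℕ.≤-trans (ℕ.≤-reflexive (double i)) (ℕ.≤-trans (ℕ.n≤1+n _) src-index))

        s+s≤ : s + s ≤ top
        s+s≤ = ℕ.≤-trans (ℕ.m≤m+n (s + s) (s + s + 2))
          (ℕ.≤-trans (ℕ.≤-reflexive (trans (sym (ℕ.+-assoc (s + s) (s + s) 2)) (quadruple s)))
            (cell 2 (s≤s (s≤s z≤n))))

        n+s< : n + s < 2^W
        n+s< = ℕ.≤-<-trans
          (ℕ.≤-trans (ℕ.+-monoʳ-≤ n (ℕ.≤-trans (ℕ.<⇒≤ s<M) (ℕ.m≤m*n M 4)))
            (ℕ.m≤m+n (n + M * 4) 6)) big<

        sub-one : q.word (q.⟦ sub ⟧ (suc s) 1) ≡ s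
        sub-one = trans ([m+n]%n≡m%n s 2^W {{q.2^w≢0}}) (small (below s≤))

        written : ∀ j {v} → v ≡ p.word (dst (j + (2 + s * 4))) → Content s (j + (2 + s * 4)) v
        written j v≡ = record
          { header = λ a<2 →
              contradiction
                (ℕ.≤-<-trans (ℕ.m≤m+n 2 (s * 4)) (ℕ.≤-<-trans (ℕ.m≤n+m (2 + s * 4) j) a<2))
                  (ℕ.<-irrefl refl)
          ; todo   = λ _ a< →
              contradiction (ℕ.≤-<-trans (ℕ.m≤n+m (2 + s * 4) j) a<) (ℕ.<-irrefl refl)
          ; done   = λ _ → v≡
          }

        unwritten : ∀ a → a < 2 + s * 4 ⊎ 6 + s * 4 ≤ a → Content s a (mm a)
        unwritten a far = record
          { header = Content.header (c a)
          ; todo   = λ 2≤a a< → Content.todo (c a) 2≤a (ℕ.≤-trans a< (ℕ.m≤n+m (2 + s * 4) 4))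
          ; done   = λ ≤a → high far ≤a
          }
          where
          high : a < 2 + s * 4 ⊎ 6 + s * 4 ≤ a → 2 + s * 4 ≤ a → mm a ≡ p.word (dst a)
          high (inj₁ a<) ≤a = contradiction (ℕ.≤-<-trans ≤a a<) (ℕ.<-irrefl refl)
          high (inj₂ a≥) _  = Content.done (c a) a≥

      -- Nine instructions of setup, four for each bit and one to leave the counting loop, seven to
      -- find the modulus and write the header, 23 for each subdivided edge and one to leave the
      -- expanding loop, then `K`.
      duration : ℕ → ℕ
      duration K = 9 + (ℓ * 4 + suc (7 + (M * 23 + suc K)))

      preprocess : ∀ {K} xs → (∀ a → q.word (src a) ≡ mem (q.start xs) a) → Halvings (n + M) ℓ →
        (∀ {R mm} → R 0 ≡ 0 → R 8 ≡ 2 ^ w → (∀ r → R (sim r) ≡ 0) → (∀ a → mm a ≡ p.word (dst a)) →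
          K Reaches ⟨ 43 , R , mm ⟩) →
        duration K Reaches q.start xs
      preprocess {K} xs contents h next =
        const-runs refl (small (ℕ.≤-<-trans (s≤s z≤n) 6<)) $
        const-runs refl (small mult<) $
        load-runs {z = n} refl refl (cell 0 src-0) $
        load-runs {z = m} refl refl (cell 1 src-1) $
        arith-runs refl refl refl (small (ℕ.≤-<-trans (ℕ.m≤n+m M n) n+M<)) $
        arith-runs refl refl refl (small n+M<) $
        arith-runs refl refl refl (small M+M<) $
        arith-runs {z = n + M} refl refl refl
          (trans (cong q.word (ℕ.+-identityʳ (n + M))) (small n+M<)) $
        const-runs refl (small (ℕ.≤-<-trans (s≤s (s≤s z≤n)) 6<)) $
        count-loop {k = 0} h record
          { r0 = refl ; r1 = refl ; r2 = refl ; r3 = refl ; r4 = refl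
          ; r5 = refl ; r6 = refl ; r7 = refl ; r8 = refl ; r9 = refl ; rs = λ _ → refl }
          n+M< bits< λ {R} k → let open Counting k in
        const-runs refl (small factor<) $
        arith-runs {z = w} refl refl r8 (trans (cong q.word (sym w≡)) (small w<)) $
        arith-runs {z = 2 ^ w} refl r1 refl
          (trans (cong q.word (ℕ.*-identityˡ (2 ^ w))) (small S.2^w<2^W)) $
        arith-runs refl r5 refl (S.truncated (n + M)) $
        arith-runs refl r6 refl (S.truncated (M + M)) $
        store-runs refl r0 refl $
        store-runs refl r1 refl $
        expand-loop M ℕ.≤-refl
          record { r0 = r0 ; r1 = r1 ; r2 = r2 ; r3 = r3 ; r4 = r4 ; r8 = refl ; r9 = r9 ; rs = rs }
          initial
          λ {R} {mm} e c → next (Expanding.r0 e) (Expanding.r8 e) (Expanding.rs e) (final {mm} c)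
        where
        6< : 6 < 2^W
        6< = ℕ.≤-<-trans (ℕ.m≤n+m 6 (n + M * 4)) big<

        n+M< : n + M < 2^W
        n+M< = ℕ.≤-<-trans (ℕ.≤-trans (ℕ.+-monoʳ-≤ n (ℕ.m≤m*n M 4)) (ℕ.m≤m+n (n + M * 4) 6)) big<

        x+x≡x*2 : ∀ x → x + x ≡ x * 2
        x+x≡x*2 = solve-∀

        M+M< : M + M < 2^W
        M+M< = ℕ.≤-<-trans
          (ℕ.≤-trans
            (ℕ.≤-trans (ℕ.≤-reflexive (x+x≡x*2 M))
              (ℕ.≤-trans (ℕ.*-monoʳ-≤ M {2} {4} (s≤s (s≤s z≤n))) (ℕ.m≤n+m (M * 4) n)))
                (ℕ.m≤m+n (n + M * 4) 6)) big<

        w< : w < 2^W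
        w< = ℕ.<-trans (n<2^n w) S.2^w<2^W

        cell : ∀ a {v} → src a ≡ v → mem (q.start xs) a ≡ v
        cell a e = trans (sym (contents a)) (trans (small (src< a)) e)

        initial : ∀ a →
          Content M a (((mem (q.start xs) [ 0 ≔ p.word (n + M) ]) [ 1 ≔ p.word (M + M) ]) a)
        initial zero = record { header = λ _ → cong p.word (sym dst-0) ; todo = λ () ; done = λ () }
        initial (suc zero) = record
          { header = λ _ → cong p.word (trans (x+x≡x*2 M) (sym dst-1))
          ; todo = λ { (s≤s ()) }
          ; done = λ { (s≤s ()) } }
        initial a@(suc (suc _)) = record
          { header = λ { (s≤s (s≤s ())) }
          ; todo   = λ _ _ → cell a refl
          ; done   = λ ≤a →
              trans (cell a (src-high a ≤a))
                (sym (trans (cong p.word (dst-high a ≤a)) (S.word-id (ℕ.m^n>0 2 w))))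
          }

        final : ∀ {mm} → (∀ a → Content 0 a (mm a)) → ∀ a → mm a ≡ p.word (dst a)
        final {mm} c a with ℕ.<-≤-connex a 2
        ... | inj₁ a<2 = Content.header (c a) a<2
        ... | inj₂ 2≤a = Content.done (c a) 2≤a

  -- The word length of the detector.

  halvings-< : ∀ {x j} → Halvings x j → x < 2 ^ j
  halvings-< over             = s≤s z≤n
  halvings-< (half {x} {j} h) = begin-strict
    suc x                            ≡⟨ m≡m%n+[m/n]*n (suc x) 2 ⟩
    suc x ℕ.% 2 + suc x / 2 * 2      <⟨ ℕ.+-monoˡ-< (suc x / 2 * 2) (m%n<n (suc x) 2) ⟩
    2 + suc x / 2 * 2                ≤⟨ ℕ.*-monoˡ-≤ 2 (halvings-< h) ⟩
    2 ^ j * 2                        ≡⟨ ℕ.*-comm (2 ^ j) 2 ⟩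
    2 ^ suc j                        ∎
    where open ℕ.≤-Reasoning

  halvings-least : ∀ {x j} e → Halvings x j → x < 2 ^ e → j ≤ e
  halvings-least e       over     _         = z≤n
  halvings-least zero    (half h) (s≤s ())
  halvings-least (suc e) (half {x} h) x<       =
    s≤s (halvings-least e h (m<n*o⇒m/o<n (subst (suc x <_) (ℕ.*-comm 2 (2 ^ e)) x<)))

  halvings-≤ : ∀ {x j} → Halvings x j → j ≤ x
  halvings-≤ {x} h = halvings-least x h (n<2^n x)

  -- Let `q` be `2 ^ suc e`. The factors `m`, `T` and 4 are at most `q * q`, `q ^ T` and `q * q`, so
  -- their product is at most `X`. So are `n` and 6, and three copies of `X` stay below four, which
  -- two further factors `q` cover; together this gives the exponent `6 + T`.
  word-capacity : ∀ n m T e → n < 2 ^ suc e → m ≤ n * n →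
    n + m * T * 4 + 6 < 2 ^ ((6 + T) * suc e)
  word-capacity n m T e n< m≤ = begin-strict
    n + m * T * 4 + 6                  ≤⟨ ℕ.+-monoˡ-≤ 6 (ℕ.+-mono-≤ n≤X mT≤X) ⟩
    X + X + 6                          ≤⟨ ℕ.+-monoʳ-≤ (X + X) 6≤X ⟩
    X + X + X                          <⟨ ℕ.m<m+n (X + X + X) (ℕ.m^n>0 q {{q≢0}} (4 + T)) ⟩
    X + X + X + X                      ≡⟨ four X ⟩
    2 * (2 * X)                        ≤⟨ ℕ.*-mono-≤ 2≤q (ℕ.*-monoˡ-≤ X 2≤q) ⟩
    q ^ (6 + T)
      ≡⟨ trans (ℕ.^-*-assoc 2 (suc e) (6 + T)) (cong (2 ^_) (ℕ.*-comm (suc e) (6 + T))) ⟩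
    2 ^ ((6 + T) * suc e)              ∎
    where
    open ℕ.≤-Reasoning
    q X : ℕ
    q = 2 ^ suc e
    X = q ^ (4 + T)
    instance
      q≢0 : NonZero q
      q≢0 = ℕ.m^n≢0 2 (suc e)

    2≤q : 2 ≤ q
    2≤q = ℕ.^-monoʳ-≤ 2 {1} {suc e} (s≤s z≤n)

    four : ∀ x → x + x + x + x ≡ 2 * (2 * x)
    four = solve-∀

    n≤X : n ≤ X
    n≤X = ℕ.≤-trans (ℕ.<⇒≤ n<)
      (ℕ.≤-trans (ℕ.≤-reflexive (sym (ℕ.*-identityʳ q))) (ℕ.^-monoʳ-≤ q {1} {4 + T} (s≤s z≤n)))

    6≤X : 6 ≤ X
    6≤X = begin
      6          ≤⟨ ℕ.m≤m+n 6 10 ⟩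
      2 ^ 4      ≤⟨ ℕ.^-monoˡ-≤ 4 2≤q ⟩
      q ^ 4      ≤⟨ ℕ.^-monoʳ-≤ q (ℕ.m≤m+n 4 T) ⟩
      X          ∎

    T≤ : T ≤ q ^ T
    T≤ = ℕ.≤-trans (ℕ.<⇒≤ (n<2^n T)) (ℕ.^-monoˡ-≤ T 2≤q)

    mT≤X : m * T * 4 ≤ X
    mT≤X = begin
      m * T * 4
        ≤⟨ ℕ.*-mono-≤ (ℕ.*-mono-≤ (ℕ.≤-trans m≤ (ℕ.*-mono-≤ (ℕ.<⇒≤ n<) (ℕ.<⇒≤ n<))) T≤)
          (ℕ.*-mono-≤ 2≤q 2≤q) ⟩
      q * q * q ^ T * (q * q)   ≡⟨ regroup q (q ^ T) ⟩
      X                         ∎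
      where
      regroup : ∀ q p → q * q * p * (q * q) ≡ q * (q * (q * (q * p)))
      regroup = solve-∀

  flatten-at-< : ∀ {n B} (es : List (Fin n × Fin n)) a → n ≤ B → 0 < B → flatten es at a < B
  flatten-at-< []             a             n≤B 0<B = subst (_< _) (sym ([]-at a)) 0<B
  flatten-at-< ((u , v) ∷ es) zero          n≤B 0<B = ℕ.<-≤-trans (Fin.toℕ<n u) n≤B
  flatten-at-< ((u , v) ∷ es) (suc zero)    n≤B 0<B = ℕ.<-≤-trans (Fin.toℕ<n v) n≤B
  flatten-at-< ((u , v) ∷ es) (suc (suc a)) n≤B 0<B = flatten-at-< es a n≤B 0<B

  -- The triangle detector.

  module TriangleAlgorithm (t : ℕ) (A : Algorithm) where
    open Algorithm A

    -- The `6 + T` of `word-capacity` with `suc t` copies of every edge.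
    capacity : ℕ
    capacity = 7 + t

    -- `wordFactor * capacity` accounts for the words of the simulated program; one more `capacity`
    -- makes the inequality strict and holds the numbers of the prefix. The prefix has 43
    -- instructions.
    detector : Algorithm
    detector = record
      { wordFactor = suc wordFactor * capacity
      ; program    = prefix wordFactor (suc t) ++ Translation.translate 43 (length program) program
      }

    module OnInput (I : Input) where
      open Input I using (n; graph; edges; isList; connected)
      open ReducedInput t I
      private
        instance
          n≢0 : NonZero n
          n≢0 = proj₁ connected
          n+M≢0 : NonZero (n + M)
          n+M≢0 = proj₁ (Input.connected input)

      e ℓ w W : ℕ
      e = ⌊log₂ n ⌋
      ℓ = suc ⌊log₂ n + M ⌋
      w = wordFactor * ℓ
      W = suc wordFactor * capacity * suc e

      big : n + M * 4 + 6 < 2 ^ (capacity * suc e)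
      big = word-capacity n m (suc t) e (halvings-< (halvings n))
        (EdgeCount.edges≤n*n graph edges isList)

      ℓ≤ : ℓ ≤ capacity * suc e
      ℓ≤ = halvings-least (capacity * suc e) (halvings (n + M))
        (ℕ.≤-<-trans (ℕ.≤-trans (ℕ.+-monoʳ-≤ n (ℕ.m≤m*n M 4)) (ℕ.m≤m+n (n + M * 4) 6)) big)

      spare : ∃ λ d → W ≡ w + suc d
      spare = W ∸ suc w , sym (trans (ℕ.+-suc w _) (ℕ.m+[n∸m]≡n w<W))
        where
        w<W : w < W
        w<W = ℕ.≤-trans (s≤s (ℕ.*-monoʳ-≤ wordFactor ℓ≤))
          (ℕ.≤-trans (ℕ.+-monoˡ-≤ (wordFactor * (capacity * suc e)) (s≤s z≤n))
          (ℕ.≤-reflexive (sym (ℕ.*-assoc (suc wordFactor) capacity (suc e)))))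

      -- The preprocessing time with 2 left for the verdict; the 3 includes leaving the last loop.
      duration : ℕ
      duration = 9 + (ℓ * 4 + suc (7 + (M * 23 + 3)))

      Answer : ℕ → Set
      Answer = SUBCNT (Pattern.pattern-graph t) input

      bound : ℕ → ℚ
      bound k = fromℕ 2 ℚ.* expectedTime A input k

      Verdict : ℕ → Set
      Verdict out = ∃ λ N → Answer N × out ≡ bool (0 ℕ.<ᵇ N)

      layout : ∀ {d} →
        Preprocessing.Layout wordFactor t w d program n m ℓ src dst refl Verdict bound
      layout = record
        { src-0 = refl
        ; src-1 = refl
        ; dst-0 = dst-0
        ; dst-1 = dst-1
        ; dst-end₁ = λ s s< →
            subst (λ s → dst (2 + s * 4) ≡ src (2 + s / suc t * 2)) (Fin.toℕ-fromℕ< s<)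
              (dst-end₁ (fromℕ< s<))
        ; dst-mid₁ = λ s s< →
            subst (λ s → dst (3 + s * 4) ≡ n + s) (Fin.toℕ-fromℕ< s<) (dst-mid₁ (fromℕ< s<))
        ; dst-end₂ = λ s s< →
            subst (λ s → dst (4 + s * 4) ≡ src (3 + s / suc t * 2)) (Fin.toℕ-fromℕ< s<)
              (dst-end₂ (fromℕ< s<))
        ; dst-mid₂ = λ s s< →
            subst (λ s → dst (5 + s * 4) ≡ n + s) (Fin.toℕ-fromℕ< s<) (dst-mid₂ (fromℕ< s<))
        ; src-high = src-fits
        ; dst-high = dst-fits
        }

      capacity≤W : capacity * suc e ≤ W
      capacity≤W = ℕ.≤-trans (ℕ.m≤m+n (capacity * suc e) (wordFactor * (capacity * suc e)))
        (ℕ.≤-reflexive (sym (ℕ.*-assoc (suc wordFactor) capacity (suc e))))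

      big-W : n + M * 4 + 6 < 2 ^ W
      big-W = ℕ.<-≤-trans big (ℕ.^-monoʳ-≤ 2 capacity≤W)

      ≤W⇒<2^W : ∀ {x} → x ≤ W → x < 2 ^ W
      ≤W⇒<2^W x≤ = ℕ.≤-<-trans x≤ (n<2^n W)

      n≤ : n ≤ n + M * 4 + 6
      n≤ = ℕ.≤-trans (ℕ.m≤m+n n (M * 4)) (ℕ.m≤m+n _ 6)

      src<2^W : ∀ a → src a < 2 ^ W
      src<2^W zero          = ℕ.≤-<-trans n≤ big-W
      src<2^W (suc zero)    = ℕ.≤-<-trans (ℕ.≤-trans (ℕ.m≤m*n m (suc t)) (ℕ.≤-trans (ℕ.m≤m*n M 4)
        (ℕ.≤-trans (ℕ.m≤n+m (M * 4) n) (ℕ.m≤m+n _ 6)))) big-W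
      src<2^W (suc (suc a)) = flatten-at-< edges a (ℕ.≤-trans n≤ (ℕ.<⇒≤ big-W)) (ℕ.m^n>0 2 W)

      fits : ∀ {d} → W ≡ w + suc d →
        Preprocessing.Fits wordFactor t w d program n m ℓ src dst refl Verdict bound
      fits W≡ = record
        { src<    = λ a → subst (λ W → src a < 2 ^ W) W≡ (src<2^W a)
        ; big<    = subst (λ W → n + M * 4 + 6 < 2 ^ W) W≡ big-W
        ; mult<   =
            subst (λ W → suc t < 2 ^ W) W≡
              (≤W⇒<2^W
                (ℕ.≤-trans (ℕ.≤-trans (ℕ.m≤n+m (suc t) 6) (ℕ.m≤m*n capacity (suc e))) capacity≤W))
        ; factor< = subst (λ W → wordFactor < 2 ^ W) W≡ (≤W⇒<2^W (ℕ.≤-trans (ℕ.n≤1+n wordFactor)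
            (ℕ.≤-trans (ℕ.m≤m*n (suc wordFactor) capacity)
              (ℕ.m≤m*n (suc wordFactor * capacity) (suc e)))))
        ; bits<   = subst (λ W → ℓ < 2 ^ W) W≡ (≤W⇒<2^W (ℕ.≤-trans ℓ≤ capacity≤W))
        }

      detector-runs : NeverErrs A input Answer →
        Runs.Runs W (Algorithm.program detector) Verdict bound duration
          (RAM.start W (Input.contents I))
      detector-runs correct =
        subst (λ W → Runs.Runs W (Algorithm.program detector) Verdict bound duration
          (RAM.start W (Input.contents I)))
        (sym (proj₂ spare))
        (preprocess layout (fits (proj₂ spare)) (Input.contents I) (λ _ → refl) (halvings (n + M))
          λ {R} {mm} r0 r8 rs mem≡ → S.simulate {s = p.start (Input.contents input)} record
            { pc≡ = refl ; reg≡ = rs ; reg< = λ _ → ℕ.m^n>0 2 w ; mem≡ = mem≡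
            ; mem< = λ a → S.word< (dst a) ; mask = r8 ; blank = r0 } correct)
        where
        d = proj₁ spare
        module p = RAM w
        module S = Simulation w d (prefix wordFactor (suc t)) program
        open Preprocessing wordFactor t w d program n m ℓ src dst refl Verdict bound
          using (preprocess)

      detector-time : NeverErrs A input Answer → ∀ k →
        expectedTime detector I k ℚ.≤ fromℕ duration ℚ.+ fromℕ 2 ℚ.* expectedTime A input k
      detector-time correct = Runs.Runs.time (detector-runs correct)

      -- Representatives covering all matches can be none only if there is no match, and the first
      -- of several is itself a match. Hence comparing the count with 0 decides whether the pattern
      -- occurs.
      verdict-sound : ∀ out → Verdict out → TriangleDetection I out
      verdict-sound out (zero  , (_ , _ , cover) , out≡) =
        inj₂ ((λ tri → no-rep (proj₁ (cover (triangle⇒match tri)))) , out≡)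
        where
        no-rep : ¬ Fin 0
        no-rep ()
      verdict-sound out (suc N , (rep , _ , _) , out≡) = inj₁ (match⇒triangle (rep zero) , out≡)

      -- The number of bits is bounded crudely by the number `n + M` itself, which is already linear
      -- in `m`. The constants sum to 24 and are absorbed using `1 ≤ m`, giving 24 + 8 = 32; the
      -- copies contribute 4 + 23 = 27 each.
      duration≤ : 1 ≤ m → duration ≤ (32 + 27 * suc t) * m
      duration≤ 1≤m = begin
        9 + (ℓ * 4 + suc (7 + (M * 23 + 3)))
          ≤⟨ ℕ.+-monoʳ-≤ 9 (ℕ.+-monoˡ-≤ _ (ℕ.*-monoˡ-≤ 4 ℓ≤n+M)) ⟩
        9 + ((1 + m * 2 + M) * 4 + suc (7 + (M * 23 + 3)))        ≡⟨ collect m (suc t) ⟩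
        24 * 1 + (8 + 27 * suc t) * m
          ≤⟨ ℕ.+-monoˡ-≤ _ (ℕ.*-monoʳ-≤ 24 1≤m) ⟩
        24 * m + (8 + 27 * suc t) * m
          ≡⟨ ℕ.*-distribʳ-+ m 24 (8 + 27 * suc t) ⟨
        (32 + 27 * suc t) * m                                     ∎
        where
        open ℕ.≤-Reasoning
        ℓ≤n+M : ℓ ≤ 1 + m * 2 + M
        ℓ≤n+M = ℕ.≤-trans (halvings-≤ (halvings (n + M)))
          (ℕ.+-monoˡ-≤ M (n≤1+edges*2 graph edges isList connected))
        collect : ∀ m T →
          9 + ((1 + m * 2 + m * T) * 4 + suc (7 + (m * T * 23 + 3))) ≡ 24 * 1 + (8 + 27 * T) * m
        collect = solve-∀

    detector-correct : LasVegas A (SUBCNT (Pattern.pattern-graph t)) →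
      LasVegas detector TriangleDetection
    detector-correct lv I = errless , fromℕ duration ℚ.+ fromℕ 2 ℚ.* proj₁ finite , λ k →
      ℚ.≤-trans (detector-time (proj₁ (lv input)) k)
        (ℚ.+-monoʳ-≤ (fromℕ duration) (ℚ.*-monoˡ-≤-nonNeg (fromℕ 2) (proj₂ finite k)))
      where
      open OnInput I
      open ReducedInput t I using (input)
      finite : FiniteExpectedTime A input
      finite = proj₂ (lv input)

      errless : NeverErrs detector I (TriangleDetection I)
      errless s r h = verdict-sound _ (Runs.Runs.correct (detector-runs (proj₁ (lv input))) s r h)

open Graphs
open Machines
open Detector
open import Data.Nat using (_+_; _*_; _^_; _≤_)
open import Data.Rational using (_<_)

-- Asymptotic estimates without roots.

0≤^ : ∀ {x} k → 0ℚ ℚ.≤ x → 0ℚ ℚ.≤ x ^ℚ k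
0≤^ zero    0≤x = 0≤fromℕ 1
0≤^ (suc k) 0≤x = 0≤* 0≤x (0≤^ k 0≤x)

^-mono : ∀ {x y} k → 0ℚ ℚ.≤ x → x ℚ.≤ y → x ^ℚ k ℚ.≤ y ^ℚ k
^-mono zero    0≤x x≤y = ℚ.≤-refl
^-mono (suc k) 0≤x x≤y = *-mono-≤ 0≤x (0≤^ k (ℚ.≤-trans 0≤x x≤y)) x≤y (^-mono k 0≤x x≤y)

^-distrib-* : ∀ x y k → (x ℚ.* y) ^ℚ k ≡ x ^ℚ k ℚ.* y ^ℚ k
^-distrib-* = Exp.^-distrib-* (CommutativeRing.commutativeSemiring ℚ.+-*-commutativeRing)

fromℕ-^ : ∀ n k → fromℕ (n ^ k) ≡ fromℕ n ^ℚ k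
fromℕ-^ n zero    = refl
fromℕ-^ n (suc k) = trans (fromℕ-* n (n ^ k)) (cong (fromℕ n ℚ.*_) (fromℕ-^ n k))

0≤expectedTime : ∀ A I k → 0ℚ ℚ.≤ expectedTime A I k
0≤expectedTime A I k = Runs.time-nonNeg _ (Algorithm.program A) k _

-- With `p` at least 1 the allowance m^(1+γ) is superlinear, which is what absorbs the linear
-- preprocessing.
positive-numerator : ∀ {γ} → 0ℚ < γ → 1 ≤ ℤ.∣ ↥ γ ∣
positive-numerator {ℚ.mkℚ (ℤ.+ suc _) _ _} _ = s≤s z≤n
positive-numerator {ℚ.mkℚ (ℤ.+ zero) _ _}  (ℚ.*<* (ℤ.+<+ ()))
positive-numerator {ℚ.mkℚ ℤ.-[1+ _ ] _ _}  _ = s≤s z≤n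

-- A positive numerator is at least 1. Replacing the constant of the lower bound by a unit fraction
-- keeps the later thresholds natural numbers.
unit≤ : ∀ c → 0ℚ < c → unit (↧ₙ c) ℚ.≤ c
unit≤ (ℚ.mkℚ (ℤ.+ zero) _ _)         (ℚ.*<* (ℤ.+<+ ()))
unit≤ (ℚ.mkℚ ℤ.-[1+ _ ] _ _)         (ℚ.*<* ())
unit≤ c@(ℚ.mkℚ (ℤ.+ suc a) d-1 _) _ = ℚ.toℚᵘ-cancel-≤ (begin
  toℚᵘ (unit (suc d-1))     ≃⟨ ℚ.toℚᵘ-fromℚᵘ (ℚᵘ.mkℚᵘ (ℤ.+ 1) d-1) ⟩
  ℚᵘ.mkℚᵘ (ℤ.+ 1) d-1
    ≤⟨ ℚᵘ.*≤* (ℤ.*-monoʳ-≤-nonNeg (ℤ.+ suc d-1) {ℤ.+ 1} {ℤ.+ suc a} (ℤ.+≤+ (s≤s z≤n))) ⟩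
  toℚᵘ c                    ∎)
  where open ℚᵘ.≤-Reasoning

degenerate-mono : ∀ {n} {G : Graph n} {d d′} → d ≤ d′ → Degenerate G d → Degenerate G d′
degenerate-mono d≤d′ D F with D F
... | v , v∈F , deg≤ = v , v∈F , ℕ.≤-trans deg≤ d≤d′

-- Constructively the degeneracy exists only up to double negation, as
-- Degenerate quantifies over all subgraphs.
¬¬degeneracy : ∀ {n} (G : Graph n) d → Degenerate G d → ¬ ¬ (∃ λ κ → κ ≤ d × IsDegeneracy G κ)
¬¬degeneracy G zero    D none = none (0 , z≤n , D , λ _ _ → z≤n)
¬¬degeneracy G (suc d) D none = none (suc d , ℕ.≤-refl , D , least)
  where
  least : ∀ d′ → Degenerate G d′ → suc d ≤ d′
  least d′ D′ with ℕ.<-≤-connex d d′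
  ... | inj₁ d<d′ = d<d′
  ... | inj₂ d′≤d = contradiction (λ (κ , κ≤d , isκ) → none (κ , ℕ.m≤n⇒m≤1+n κ≤d , isκ))
                      (¬¬degeneracy G d (degenerate-mono {G = G} d′≤d D′))

ℕ-^-distrib-* : ∀ a b k → (a * b) ^ k ≡ a ^ k * b ^ k
ℕ-^-distrib-* a b zero    = refl
ℕ-^-distrib-* a b (suc k) =
  trans (cong (a * b *_) (ℕ-^-distrib-* a b k)) (interchange a b (a ^ k) (b ^ k))
  where
  interchange : ∀ a b x y → a * b * (x * y) ≡ a * x * (b * y)
  interchange = solve-∀

-- Roots are avoided by splitting on which of the two summands dominates.
module Threshold (q-1 p C K-1 N-1 : ℕ) (1≤p : 1 ≤ p) where
  private
    q K N L : ℕ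
    q = suc q-1
    K = suc K-1
    N = suc N-1
    -- One factor 2 is the slowdown of the simulation and the other comes from the dominating
    -- summand; `K ^ (1 + p)` pays for the expanded graph having `K` times as many edges.
    L = 4 * K ^ (1 + p)
    instance
      L≢0 : NonZero L
      L≢0 = ℕ.m*n≢0 4 (K ^ (1 + p)) {{_}} {{ℕ.m^n≢0 K (1 + p)}}
      L*N≢0 : NonZero (L * N)
      L*N≢0 = ℕ.m*n≢0 L N

  -- From here on `(N * (2 * C) * m) ^ q` is at most `m * m ^ q`, hence at most `m ^ (q + p)`.
  threshold : ℕ
  threshold = (N * (2 * C)) ^ q

  -- Chosen so that `L` times it is `unit N`.
  δ : ℚ
  δ = unit (L * N)

  double : ∀ x → x ℚ.+ x ≡ fromℕ 2 ℚ.* x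
  double x = sym (trans (ℚ.*-distribʳ-+ x 1ℚ 1ℚ) (cong₂ ℚ._+_ (ℚ.*-identityˡ x) (ℚ.*-identityˡ x)))

  -- The case in which preprocessing dominates: `unit N` is factored out of the linear bound, and
  -- what remains is the `q`-th power that `threshold` controls.
  linear-small : ∀ {m x} → threshold ≤ m → 1 ≤ m → 0ℚ ℚ.≤ x → x ℚ.≤ fromℕ (2 * (C * m)) →
    x ^ℚ q ℚ.≤ unit N ^ℚ q ℚ.* fromℕ (m ^ (q + p))
  linear-small {m} {x} large 1≤m 0≤x x≤ = begin
    x ^ℚ q                                             ≤⟨ ^-mono q 0≤x x≤ ⟩
    fromℕ (2 * (C * m)) ^ℚ q                           ≡⟨ cong (_^ℚ q) scaled ⟩
    (unit N ℚ.* fromℕ (N * (2 * C) * m)) ^ℚ q          ≡⟨ ^-distrib-* (unit N) _ q ⟩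
    unit N ^ℚ q ℚ.* fromℕ (N * (2 * C) * m) ^ℚ q
      ≡⟨ cong (unit N ^ℚ q ℚ.*_) (fromℕ-^ (N * (2 * C) * m) q) ⟨
    unit N ^ℚ q ℚ.* fromℕ ((N * (2 * C) * m) ^ q)
      ≤⟨ ℚ.*-monoˡ-≤-nonNeg (unit N ^ℚ q) {{ℚ.nonNegative (0≤^ q (0≤unit N))}}
        (fromℕ-mono-≤ power) ⟩
    unit N ^ℚ q ℚ.* fromℕ (m ^ (q + p))                ∎
    where
    open ℚ.≤-Reasoning
    regroup : ∀ N C m → N * (2 * C) * m ≡ 2 * (C * m) * N
    regroup = solve-∀

    scaled : fromℕ (2 * (C * m)) ≡ unit N ℚ.* fromℕ (N * (2 * C) * m)
    scaled =
      sym (trans (cong (λ y → unit N ℚ.* fromℕ y) (regroup N C m))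
        (trans (cong (unit N ℚ.*_) (fromℕ-* (2 * (C * m)) N))
      (trans (ℚ.*-comm (unit N) _) (trans (ℚ.*-assoc (fromℕ (2 * (C * m))) (fromℕ N) (unit N))
        (trans (cong (fromℕ (2 * (C * m)) ℚ.*_) (fromℕ*unit N)) (ℚ.*-identityʳ _))))))

    power : (N * (2 * C) * m) ^ q ≤ m ^ (q + p)
    power = ℕ.≤-trans
      (ℕ.≤-reflexive (trans (ℕ-^-distrib-* (N * (2 * C)) m q) (ℕ.*-comm threshold (m ^ q))))
      (ℕ.≤-trans
        (ℕ.*-monoʳ-≤ (m ^ q) (ℕ.≤-trans large (ℕ.≤-trans (ℕ.≤-reflexive (sym (ℕ.*-identityʳ m)))
        (ℕ.^-monoʳ-≤ m {{ℕ.>-nonZero 1≤m}} 1≤p)))) (ℕ.≤-reflexive (sym (ℕ.^-distribˡ-+-* m q p))))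

  -- The case in which the simulated program dominates: its bound holds at `K * m` edges, and the
  -- smallness of `u` compensates both for `K` and for the factor 4.
  superlinear-small : ∀ {m x y u} → 0ℚ ℚ.≤ x → 0ℚ ℚ.≤ y → x ℚ.≤ fromℕ 4 ℚ.* y → 0ℚ ℚ.≤ u → u ℚ.≤ δ →
    y ^ℚ q ℚ.≤ u ^ℚ q ℚ.* fromℕ ((K * m) ^ (q + p)) →
    x ^ℚ q ℚ.≤ unit N ^ℚ q ℚ.* fromℕ (m ^ (q + p))
  superlinear-small {m} {x} {y} {u} 0≤x 0≤y x≤ 0≤u u≤δ y≤ = begin
    x ^ℚ q                                                         ≤⟨ ^-mono q 0≤x x≤ ⟩
    (fromℕ 4 ℚ.* y) ^ℚ q                                           ≡⟨ ^-distrib-* (fromℕ 4) y q ⟩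
    fromℕ 4 ^ℚ q ℚ.* y ^ℚ q
      ≤⟨ ℚ.*-monoˡ-≤-nonNeg (fromℕ 4 ^ℚ q) {{ℚ.nonNegative (0≤^ q (0≤fromℕ 4))}} y^q≤ ⟩
    fromℕ 4 ^ℚ q ℚ.* (δ ^ℚ q ℚ.* fromℕ ((K ^ (1 + p)) ^ q * m ^ (q + p)))
      ≡⟨ cong (λ z → fromℕ 4 ^ℚ q ℚ.* (δ ^ℚ q ℚ.* z))
           (trans (fromℕ-* ((K ^ (1 + p)) ^ q) (m ^ (q + p)))
             (cong (ℚ._* fromℕ (m ^ (q + p))) (fromℕ-^ (K ^ (1 + p)) q))) ⟩
    fromℕ 4 ^ℚ q ℚ.* (δ ^ℚ q ℚ.* (fromℕ (K ^ (1 + p)) ^ℚ q ℚ.* Y))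
      ≡⟨ collect (fromℕ 4 ^ℚ q) (δ ^ℚ q) (fromℕ (K ^ (1 + p)) ^ℚ q) Y ⟩
    fromℕ 4 ^ℚ q ℚ.* fromℕ (K ^ (1 + p)) ^ℚ q ℚ.* δ ^ℚ q ℚ.* Y
      ≡⟨ cong (ℚ._* Y)
        (trans (cong (ℚ._* δ ^ℚ q) (sym (^-distrib-* (fromℕ 4) (fromℕ (K ^ (1 + p))) q)))
          (sym (^-distrib-* (fromℕ 4 ℚ.* fromℕ (K ^ (1 + p))) δ q))) ⟩
    (fromℕ 4 ℚ.* fromℕ (K ^ (1 + p)) ℚ.* δ) ^ℚ q ℚ.* Y
      ≡⟨ cong (λ z → z ^ℚ q ℚ.* Y)
        (trans (cong (ℚ._* δ) (sym (fromℕ-* 4 (K ^ (1 + p))))) (unit-* L N)) ⟩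
    unit N ^ℚ q ℚ.* Y                                              ∎
    where
    open ℚ.≤-Reasoning
    Y : ℚ
    Y = fromℕ (m ^ (q + p))

    collect : ∀ a b c d → a ℚ.* (b ℚ.* (c ℚ.* d)) ≡ a ℚ.* c ℚ.* b ℚ.* d
    collect a b c d =
      trans (cong (a ℚ.*_) (trans (sym (ℚ.*-assoc b c d)) (cong (ℚ._* d) (ℚ.*-comm b c))))
      (trans (sym (ℚ.*-assoc a (c ℚ.* b) d)) (cong (ℚ._* d) (sym (ℚ.*-assoc a c b))))

    y^q≤ : y ^ℚ q ℚ.≤ δ ^ℚ q ℚ.* fromℕ ((K ^ (1 + p)) ^ q * m ^ (q + p))
    y^q≤ = ℚ.≤-trans y≤ (*-mono-≤ (0≤^ q 0≤u) (0≤fromℕ ((K ^ (1 + p)) ^ q * m ^ (q + p)))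
      (^-mono q 0≤u u≤δ) (fromℕ-mono-≤ power))
      where
      power : (K * m) ^ (q + p) ≤ (K ^ (1 + p)) ^ q * m ^ (q + p)
      -- The exponent of `K` is raised from `q + p` to `(1 + p) * q`, so that the constant becomes a
      -- `q`-th power and can be moved inside the root-free inequality.
      power = ℕ.≤-trans (ℕ.≤-reflexive (ℕ-^-distrib-* K m (q + p)))
        (ℕ.*-monoˡ-≤ (m ^ (q + p)) (ℕ.≤-trans (ℕ.^-monoʳ-≤ K (ℕ.+-monoʳ-≤ q (ℕ.m≤m*n p q)))
          (ℕ.≤-reflexive (sym (ℕ.^-*-assoc K (1 + p) q)))))

  total-small : ∀ {m D x y u} → threshold ≤ m → 1 ≤ m → D ≤ C * m → 0ℚ ℚ.≤ x → 0ℚ ℚ.≤ y →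
    x ℚ.≤ fromℕ D ℚ.+ fromℕ 2 ℚ.* y → 0ℚ ℚ.≤ u → u ℚ.≤ δ →
    y ^ℚ q ℚ.≤ u ^ℚ q ℚ.* fromℕ ((K * m) ^ (q + p)) →
    x ^ℚ q ℚ.≤ unit N ^ℚ q ℚ.* fromℕ (m ^ (q + p))
  total-small {m} {D} {x} {y} large 1≤m D≤ 0≤x 0≤y x≤ 0≤u u≤δ y≤ with ℚ.≤-total (fromℕ 2 ℚ.* y)
    (fromℕ (C * m))
  ... | inj₁ 2y≤ =
      linear-small large 1≤m 0≤x (ℚ.≤-trans x≤ (ℚ.≤-trans (ℚ.+-mono-≤ (fromℕ-mono-≤ D≤) 2y≤)
          (ℚ.≤-reflexive (trans (double (fromℕ (C * m))) (sym (fromℕ-* 2 (C * m)))))))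
  ... | inj₂ ≤2y =
      superlinear-small {m} 0≤x 0≤y
        (ℚ.≤-trans x≤ (ℚ.≤-trans (ℚ.+-monoˡ-≤ (fromℕ 2 ℚ.* y) (ℚ.≤-trans (fromℕ-mono-≤ D≤) ≤2y))
          (ℚ.≤-reflexive
            (trans (double (fromℕ 2 ℚ.* y)) (sym (ℚ.*-assoc (fromℕ 2) (fromℕ 2) y)))))) 0≤u u≤δ y≤

-- Contradiction with the conjecture.

theorem18 : TriangleDetectionConjecture →
    ∃[ γ ] 0ℚ < γ ×
    (∀ (k : ℕ) → 6 ≤ k → ∀ (f : ℕ → ℕ) →
    Σ (Graph k) λ H → Connected H ×
    ¬ (∃[ A ] LasVegas A (SUBCNT H) × LittleO A γ f))
theorem18 (γ , 0<γ , hard) = γ , 0<γ , λ k 6≤k f → pattern-for k (ℕ.m≤n⇒∃[o]m+o≡n 6≤k) f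
  where
  no-algorithm : ∀ t f → ¬ (∃[ A ] LasVegas A (SUBCNT (Pattern.pattern-graph t)) × LittleO A γ f)
  no-algorithm t f (A , correct , h , 0≤h , h→0 , fast) =
    -- The goal is a negation, so double-negated existence of the degeneracy suffices.
    ¬¬degeneracy reduced 2 (Subdivision.subdivision-degenerate end₁ end₂) λ (κ , κ≤2 , isκ) →
      proj₂ (proj₂ hard-input) (detector-fast κ κ≤2 isκ)
    where
    open TriangleAlgorithm t A
    lower-bound : BigOmega detector γ
    lower-bound = hard detector (detector-correct correct)

    c : ℚ
    c = proj₁ lower-bound

    0<c : 0ℚ < c
    0<c = proj₁ (proj₂ lower-bound)

    M₀ : ℕ
    M₀ = proj₁ (proj₂ (proj₂ lower-bound))

    C K F : ℕ
    C = 32 + 27 * suc t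
    K = suc t * 2
    -- A bound for `f` on the possible degeneracies 0, 1, 2 of an expanded graph.
    F = f 0 + (f 1 + f 2)

    open Threshold (ℚ.denominator-1 γ) ℤ.∣ ↥ γ ∣ C (suc (t * 2)) (ℚ.denominator-1 c)
      (positive-numerator 0<γ)

    small : ∃[ η ] 0ℚ < η × (∀ {x} → 0ℚ ℚ.≤ x → x < η → ∀ {a} → a ≤ F → x ℚ.* fromℕ a ℚ.≤ δ)
    small = unit η⁻¹ , 0<unit η⁻¹ , λ {x} 0≤x x<η {a} a≤F → ℚ.≤-trans
      (*-mono-≤ 0≤x (0≤fromℕ (suc F)) (ℚ.<⇒≤ x<η) (fromℕ-mono-≤ (ℕ.m≤n⇒m≤1+n a≤F)))
      (ℚ.≤-reflexive (trans (ℚ.*-comm (unit η⁻¹) (fromℕ (suc F))) (unit-* (suc F) δ⁻¹)))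
      where
      δ⁻¹ η⁻¹ : ℕ
      δ⁻¹ = 4 * K ^ (1 + ℤ.∣ ↥ γ ∣) * ↧ₙ c
      -- If `h` is below `unit η⁻¹`, then `h` times a value at most `F` is at most `δ`; `suc` keeps
      -- the denominator nonzero when `F` is 0.
      η⁻¹ = suc F * δ⁻¹
      instance
        δ⁻¹≢0 : NonZero δ⁻¹
        δ⁻¹≢0 = ℕ.m*n≢0 (4 * K ^ (1 + ℤ.∣ ↥ γ ∣))
          (↧ₙ c) {{ℕ.m*n≢0 4 _ {{_}} {{ℕ.m^n≢0 K (1 + ℤ.∣ ↥ γ ∣)}}}}
        η⁻¹≢0 : NonZero η⁻¹
        η⁻¹≢0 = ℕ.m*n≢0 (suc F) δ⁻¹

    η : ℚ
    η = proj₁ small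

    M₁ : ℕ
    M₁ = proj₁ (h→0 η (proj₁ (proj₂ small)))

    size : ℕ
    -- Past `M₀` the conjecture supplies a hard input, past `M₁` the factor `h` is below `η` on its
    -- expansion, which has at least as many edges, and past `threshold` the preprocessing is
    -- negligible. The `suc` guarantees an edge.
    size = suc (M₀ + (M₁ + threshold))

    hard-input : ∃[ I ] Input.m I ≡ size × ¬ RunsWithin detector I c γ
    hard-input = proj₂ (proj₂ (proj₂ lower-bound)) size (ℕ.m≤n⇒m≤1+n (ℕ.m≤m+n M₀ _))

    I : Input
    I = proj₁ hard-input

    open OnInput I using (duration; duration≤; detector-time)
    open ReducedInput t I using (m; M; reduced; end₁; end₂; input; length-reduced)

    m≡size : m ≡ size
    m≡size = proj₁ (proj₂ hard-input)

    1≤m : 1 ≤ m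
    1≤m = subst (1 ≤_) (sym m≡size) (s≤s z≤n)

    m-input : Input.m input ≡ K * m
    m-input = trans length-reduced (trans (ℕ.*-assoc m (suc t) 2) (ℕ.*-comm m K))

    m≤m-input : m ≤ Input.m input
    m≤m-input = subst (m ≤_) (sym m-input) (ℕ.m≤n*m m K)

    M₁≤ : M₁ ≤ Input.m input
    M₁≤ = ℕ.≤-trans (ℕ.m≤n⇒m≤1+n (ℕ.≤-trans (ℕ.m≤m+n M₁ threshold) (ℕ.m≤n+m _ M₀)))
      (subst (_≤ Input.m input) m≡size m≤m-input)

    threshold≤ : threshold ≤ m
    threshold≤ =
      subst (threshold ≤_) (sym m≡size)
        (ℕ.m≤n⇒m≤1+n (ℕ.≤-trans (ℕ.m≤n+m threshold M₁) (ℕ.m≤n+m _ M₀)))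

    f≤F : ∀ {κ} → κ ≤ 2 → f κ ≤ F
    f≤F {0} _ = ℕ.m≤m+n (f 0) _
    f≤F {1} _ = ℕ.≤-trans (ℕ.m≤m+n (f 1) (f 2)) (ℕ.m≤n+m _ (f 0))
    f≤F {2} _ = ℕ.≤-trans (ℕ.m≤n+m (f 2) (f 1)) (ℕ.m≤n+m _ (f 0))
    f≤F {suc (suc (suc _))} (s≤s (s≤s ()))

    detector-fast : ∀ κ → κ ≤ 2 → IsDegeneracy reduced κ → RunsWithin detector I c γ
    detector-fast κ κ≤2 isκ j = ℚ.≤-trans
      (total-small threshold≤ 1≤m (duration≤ 1≤m) (0≤expectedTime detector I j)
        (0≤expectedTime A input j)
        (detector-time (proj₁ (correct input)) j) (0≤* (0≤h (Input.m input)) (0≤fromℕ (f κ)))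
        (proj₂ (proj₂ small) (0≤h (Input.m input))
          (proj₂ (h→0 η (proj₁ (proj₂ small))) (Input.m input) M₁≤) (f≤F κ≤2))
        (subst (λ x → expectedTime A input j ^ℚ (↧ₙ γ) ℚ.≤
            (h (Input.m input) ℚ.* fromℕ (f κ)) ^ℚ (↧ₙ γ) ℚ.* fromℕ
              (x ^ (↧ₙ γ + ℤ.∣ ↥ γ ∣))) m-input
          (fast input κ (ℕ.≤-trans 1≤m m≤m-input) isκ j)))
      -- Passes from `unit (↧ₙ c)` back to the constant `c` of the lower bound.
      (ℚ.*-monoʳ-≤-nonNeg
        (fromℕ (m ^ (↧ₙ γ + ℤ.∣ ↥ γ ∣))) {{ℚ.nonNegative (0≤fromℕ (m ^ (↧ₙ γ + ℤ.∣ ↥ γ ∣)))}}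
        (^-mono (↧ₙ γ) (0≤unit (↧ₙ c)) (unit≤ c 0<c)))

  pattern-for : ∀ k → (∃[ t ] 6 + t ≡ k) → (f : ℕ → ℕ) →
    Σ (Graph k) λ H → Connected H × ¬ (∃[ A ] LasVegas A (SUBCNT H) × LittleO A γ f)
  pattern-for _ (t , refl) f =
    Pattern.pattern-graph t , Pattern.pattern-connected t , no-algorithm t f
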